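{- Let $k\ge 0$ be a fixed integer and let $p=p(n)$ satisfy $p=o(1)$ as $n\to\infty$. Let $R$ be a random subset of the cyclic group $C_n$ obtained by choosing each element of $C_n$ independently with probability $p$, and let $N^R_{n-1-k}$ be the number of zero-sum free sequences of length $n-1-k$ contained in $R$. Then $$\mathbb E\left(N^R_{n-1-k}\right)=p\,\varphi(n)\left(1+O_k(p)\right)\qquad (n\to\infty),$$ where the constant in $O_k$ depends only on $k$ and $\varphi(n)$ denotes the number of generators of $C_n$.
   Context: $C_n$ is the cyclic group of order $n$, written additively. A sequence of length $\ell$ over $C_n$ is an unordered collection with repetition allowed (a multiset) $S=a_1\cdot a_2\cdot\ldots\cdot a_\ell$ of $\ell$ elements of $C_n$. A subsequence of $S$ is a sequence $T$ in which the multiplicity of each $a\in C_n$ is at most its multiplicity in $S$. $S$ is a zero-sum sequence if $a_1+\dots+a_\ell=0$, and $S$ is zero-sum free if it contains no (nonempty) zero-sum subsequence. $S$ is contained in $A\subset C_n$ if every element occurring in $S$ lies in $A$. -}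

module Defs where

open import Algebra.Bundles using (AbelianGroup; CommutativeRing)
import Algebra.Definitions.RawMonoid as RawMonoidDefinitions
open import Algebra.Structures using (IsAbelianGroup)
open import Data.Bool using (if_then_else_)
open import Data.Fin using (Fin; zero; suc; toℕ)
import Data.Fin.Properties as Fin
open import Data.Fin.Subset using (Subset; inside; outside; _∈_)
open import Data.Fin.Subset.Properties using (_∈?_)
import Data.Integer as ℤ
open import Data.List as List using (List; []; _∷_; _++_; allFin; filter)
open import Data.List.Membership.Propositional using () renaming (_∈_ to _∈ˡ_)
open import Data.List.Membership.Propositional.Properties
  using (∈-++⁺ˡ; ∈-++⁺ʳ; ∈-++⁻; ∈-map⁺; ∈-map⁻)
open import Data.List.Relation.Unary.Any using (here; there)
open import Data.List.Relation.Unary.All using ([])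
open import Data.List.Relation.Unary.AllPairs using ([]; _∷_)
open import Data.List.Relation.Unary.Unique.Propositional using (Unique)
import Data.List.Relation.Unary.Unique.Propositional.Properties as Unique
open import Data.Nat as ℕ using (ℕ; zero; suc; NonZero)
open import Data.Nat.DivMod
  using (_%_; _mod_; m%n<n; m<n⇒m%n≡m; m%n%n≡m%n; %-distribˡ-+; %-distribˡ-*; n%n≡0; m*n%n≡0)
import Data.Nat.Properties as ℕ
open import Data.Product using (∃; _×_; _,_)
open import Data.Rational as ℚ using (ℚ; 0ℚ; 1ℚ; ½)
import Data.Rational.Properties as ℚ
open import Data.Rational.Solver using (module +-*-Solver)
open import Data.Sum using (inj₁; inj₂)
open import Data.Vec as Vec using (Vec; []; _∷_; lookup)
import Data.Vec.Properties as Vec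
open import Data.Vec.Functional using (Vector)
open import Level using (0ℓ)
open import Relation.Binary.PropositionalEquality
  using (_≡_; refl; sym; trans; cong; cong₂; subst; subst₂; isEquivalence; module ≡-Reasoning)
open import Relation.Nullary using (¬_; Dec)
open import Relation.Nullary.Decidable using (map′; ¬?; _×-dec_; _→-dec_)

Eventually : (ℕ → Set) → Set
Eventually P = ∃ λ N → ∀ n → N ℕ.≤ n → P n

both : ∀ {P Q R : ℕ → Set} → (∀ n → P n → Q n → R n) →
       Eventually P → Eventually Q → Eventually R
both f (M , p) (N , q) = M ℕ.⊔ N , λ n M⊔N≤n →
  f n (p n (ℕ.m⊔n≤o⇒m≤o M N M⊔N≤n)) (q n (ℕ.m⊔n≤o⇒n≤o M N M⊔N≤n))

IsCauchy : (ℕ → ℚ) → Set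
IsCauchy x = ∀ ε → 0ℚ ℚ.< ε →
  ∃ λ N → ∀ m n → N ℕ.≤ m → N ℕ.≤ n → ℚ.∣ x m ℚ.- x n ∣ ℚ.≤ ε

-- The intended equality is _≈_ below, not _≡_.
record ℝ : Set where
  constructor mkℝ
  field
    seq    : ℕ → ℚ
    cauchy : IsCauchy seq

open ℝ public

infix 4 _≈_ _≤_

_≈_ : ℝ → ℝ → Set
x ≈ y = ∀ ε → 0ℚ ℚ.< ε → Eventually λ n → ℚ.∣ seq x n ℚ.- seq y n ∣ ℚ.≤ ε

_≤_ : ℝ → ℝ → Set
x ≤ y = ∀ ε → 0ℚ ℚ.< ε → Eventually λ n → seq x n ℚ.≤ seq y n ℚ.+ ε

half : ∀ {ε} → 0ℚ ℚ.< ε → 0ℚ ℚ.< ½ ℚ.* ε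
half {ε} 0<ε = subst (ℚ._< ½ ℚ.* ε) (ℚ.*-zeroʳ ½) (ℚ.*-monoʳ-<-pos ½ 0<ε)

halves : ∀ ε → ½ ℚ.* ε ℚ.+ ½ ℚ.* ε ≡ ε
halves ε = trans (sym (ℚ.*-distribʳ-+ ε ½ ½)) (ℚ.*-identityˡ ε)

-‿self : ∀ a → ℚ.∣ a ℚ.- a ∣ ≡ 0ℚ
-‿self a = cong ℚ.∣_∣ (ℚ.+-inverseʳ a)

∣-∣-sym : ∀ a b → ℚ.∣ a ℚ.- b ∣ ≡ ℚ.∣ b ℚ.- a ∣
∣-∣-sym a b = trans (sym (ℚ.∣-p∣≡∣p∣ (a ℚ.- b)))
  (cong ℚ.∣_∣ (solve 2 (λ a b → :- (a :- b) := b :- a) refl a b))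
  where open +-*-Solver

triangle : ∀ a b c → ℚ.∣ a ℚ.- c ∣ ℚ.≤ ℚ.∣ a ℚ.- b ∣ ℚ.+ ℚ.∣ b ℚ.- c ∣
triangle a b c = subst (λ d → ℚ.∣ d ∣ ℚ.≤ ℚ.∣ a ℚ.- b ∣ ℚ.+ ℚ.∣ b ℚ.- c ∣)
  (solve 3 (λ a b c → (a :- b) :+ (b :- c) := a :- c) refl a b c)
  (ℚ.∣p+q∣≤∣p∣+∣q∣ (a ℚ.- b) (b ℚ.- c))
  where open +-*-Solver

+-dist : ∀ a a′ b b′ →
  ℚ.∣ (a ℚ.+ b) ℚ.- (a′ ℚ.+ b′) ∣ ℚ.≤ ℚ.∣ a ℚ.- a′ ∣ ℚ.+ ℚ.∣ b ℚ.- b′ ∣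
+-dist a a′ b b′ = subst (λ d → ℚ.∣ d ∣ ℚ.≤ ℚ.∣ a ℚ.- a′ ∣ ℚ.+ ℚ.∣ b ℚ.- b′ ∣)
  (solve 4 (λ a a′ b b′ → (a :- a′) :+ (b :- b′) := (a :+ b) :- (a′ :+ b′)) refl a a′ b b′)
  (ℚ.∣p+q∣≤∣p∣+∣q∣ (a ℚ.- a′) (b ℚ.- b′))
  where open +-*-Solver

neg-dist : ∀ a b → ℚ.∣ ℚ.- a ℚ.- ℚ.- b ∣ ≡ ℚ.∣ a ℚ.- b ∣
neg-dist a b = trans
  (cong ℚ.∣_∣ (solve 2 (λ a b → :- a :- :- b := :- (a :- b)) refl a b))
  (ℚ.∣-p∣≡∣p∣ (a ℚ.- b))
  where open +-*-Solver

∣a∣≤∣b∣+∣a-b∣ : ∀ a b → ℚ.∣ a ∣ ℚ.≤ ℚ.∣ b ∣ ℚ.+ ℚ.∣ a ℚ.- b ∣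
∣a∣≤∣b∣+∣a-b∣ a b = subst (λ d → ℚ.∣ d ∣ ℚ.≤ ℚ.∣ b ∣ ℚ.+ ℚ.∣ a ℚ.- b ∣)
  (solve 2 (λ a b → b :+ (a :- b) := a) refl a b)
  (ℚ.∣p+q∣≤∣p∣+∣q∣ b (a ℚ.- b))
  where open +-*-Solver

∣a∣-∣b∣≤∣a-b∣ : ∀ a b → ℚ.∣ a ∣ ℚ.- ℚ.∣ b ∣ ℚ.≤ ℚ.∣ a ℚ.- b ∣
∣a∣-∣b∣≤∣a-b∣ a b = subst (ℚ.∣ a ∣ ℚ.- ℚ.∣ b ∣ ℚ.≤_)
  (solve 2 (λ b d → (b :+ d) :- b := d) refl ℚ.∣ b ∣ ℚ.∣ a ℚ.- b ∣)
  (ℚ.+-monoˡ-≤ (ℚ.- ℚ.∣ b ∣) (∣a∣≤∣b∣+∣a-b∣ a b))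
  where open +-*-Solver

abs-dist : ∀ a b → ℚ.∣ ℚ.∣ a ∣ ℚ.- ℚ.∣ b ∣ ∣ ℚ.≤ ℚ.∣ a ℚ.- b ∣
abs-dist a b with ℚ.∣p∣≡p∨∣p∣≡-p (ℚ.∣ a ∣ ℚ.- ℚ.∣ b ∣)
... | inj₁ eq = subst (ℚ._≤ ℚ.∣ a ℚ.- b ∣) (sym eq) (∣a∣-∣b∣≤∣a-b∣ a b)
... | inj₂ eq = subst₂ ℚ._≤_
  (trans (solve 2 (λ a b → b :- a := :- (a :- b)) refl ℚ.∣ a ∣ ℚ.∣ b ∣) (sym eq))
  (∣-∣-sym b a)
  (∣a∣-∣b∣≤∣a-b∣ b a)
  where open +-*-Solver

≤-mul : ∀ {a A b B} → ℚ.∣ a ∣ ℚ.≤ A → ℚ.∣ b ∣ ℚ.≤ B → ℚ.∣ a ∣ ℚ.* ℚ.∣ b ∣ ℚ.≤ A ℚ.* B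
≤-mul {a} {A} {b} {B} a≤A b≤B = ℚ.≤-trans
  (ℚ.*-monoʳ-≤-nonNeg ℚ.∣ b ∣ {{ℚ.∣-∣-nonNeg b}} a≤A)
  (ℚ.*-monoˡ-≤-nonNeg A {{ℚ.nonNegative (ℚ.≤-trans (ℚ.0≤∣p∣ a) a≤A)}} b≤B)

*-dist : ∀ {A B α β} a a′ b b′ → ℚ.∣ a ∣ ℚ.≤ A → ℚ.∣ b′ ∣ ℚ.≤ B →
  ℚ.∣ a ℚ.- a′ ∣ ℚ.≤ α → ℚ.∣ b ℚ.- b′ ∣ ℚ.≤ β →
  ℚ.∣ a ℚ.* b ℚ.- a′ ℚ.* b′ ∣ ℚ.≤ A ℚ.* β ℚ.+ B ℚ.* α
*-dist {A} {B} {α} {β} a a′ b b′ a≤A b′≤B α≥ β≥ = begin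
  ℚ.∣ a ℚ.* b ℚ.- a′ ℚ.* b′ ∣
    ≡⟨ cong ℚ.∣_∣ (solve 4 (λ a a′ b b′ →
         a :* b :- a′ :* b′ := a :* (b :- b′) :+ b′ :* (a :- a′)) refl a a′ b b′) ⟩
  ℚ.∣ a ℚ.* (b ℚ.- b′) ℚ.+ b′ ℚ.* (a ℚ.- a′) ∣
    ≤⟨ ℚ.∣p+q∣≤∣p∣+∣q∣ (a ℚ.* (b ℚ.- b′)) (b′ ℚ.* (a ℚ.- a′)) ⟩
  ℚ.∣ a ℚ.* (b ℚ.- b′) ∣ ℚ.+ ℚ.∣ b′ ℚ.* (a ℚ.- a′) ∣
    ≡⟨ cong₂ ℚ._+_ (ℚ.∣p*q∣≡∣p∣*∣q∣ a (b ℚ.- b′)) (ℚ.∣p*q∣≡∣p∣*∣q∣ b′ (a ℚ.- a′)) ⟩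
  ℚ.∣ a ∣ ℚ.* ℚ.∣ b ℚ.- b′ ∣ ℚ.+ ℚ.∣ b′ ∣ ℚ.* ℚ.∣ a ℚ.- a′ ∣
    ≤⟨ ℚ.+-mono-≤ (≤-mul {a} {_} {b ℚ.- b′} a≤A β≥) (≤-mul {b′} {_} {a ℚ.- a′} b′≤B α≥) ⟩
  A ℚ.* β ℚ.+ B ℚ.* α ∎
  where open +-*-Solver
        open ℚ.≤-Reasoning

scale : ∀ B ε → 0ℚ ℚ.< B → 0ℚ ℚ.< ε → ∃ λ δ → 0ℚ ℚ.< δ × B ℚ.* δ ≡ ε
scale B ε 0<B 0<ε = ℚ.1/ B ℚ.* ε
  , subst (ℚ._< ℚ.1/ B ℚ.* ε) (ℚ.*-zeroʳ (ℚ.1/ B)) (ℚ.*-monoʳ-<-pos (ℚ.1/ B) 0<ε)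
  , trans (sym (ℚ.*-assoc B (ℚ.1/ B) ε))
      (trans (cong (ℚ._* ε) (ℚ.*-inverseʳ B)) (ℚ.*-identityˡ ε))
  where
    instance
      B-pos : ℚ.Positive B
      B-pos = ℚ.positive 0<B
      B-nonZero : ℚ.NonZero B
      B-nonZero = ℚ.pos⇒nonZero B
      1/B-pos : ℚ.Positive (ℚ.1/ B)
      1/B-pos = ℚ.1/pos⇒pos B

bounded : ∀ {x} → IsCauchy x → ∃ λ B → 0ℚ ℚ.< B × Eventually λ n → ℚ.∣ x n ∣ ℚ.≤ B
bounded {x} c with c 1ℚ (ℚ.positive⁻¹ 1ℚ)
... | N , h = ℚ.∣ x N ∣ ℚ.+ 1ℚ
  , ℚ.+-mono-≤-< (ℚ.0≤∣p∣ (x N)) (ℚ.positive⁻¹ 1ℚ)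
  , N , λ n N≤n → ℚ.≤-trans (∣a∣≤∣b∣+∣a-b∣ (x n) (x N))
      (ℚ.+-monoʳ-≤ ℚ.∣ x N ∣ (h n N N≤n ℕ.≤-refl))

fromℚ : ℚ → ℝ
fromℚ q = mkℝ (λ _ → q) λ ε 0<ε → 0 , λ _ _ _ _ →
  subst (ℚ._≤ ε) (sym (-‿self q)) (ℚ.<⇒≤ 0<ε)

fromℕ : ℕ → ℝ
fromℕ n = fromℚ (ℤ.+ n ℚ./ 1)

0ℝ 1ℝ : ℝ
0ℝ = fromℚ 0ℚ
1ℝ = fromℚ 1ℚ

infixl 6 _+_ _-_
infixl 7 _*_
infix  8 -_

_+_ : ℝ → ℝ → ℝ
mkℝ x cx + mkℝ y cy = mkℝ (λ n → x n ℚ.+ y n) λ ε 0<ε →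
  let M , hx = cx (½ ℚ.* ε) (half 0<ε)
      N , hy = cy (½ ℚ.* ε) (half 0<ε)
  in M ℕ.⊔ N , λ m n ≤m ≤n → ℚ.≤-trans (+-dist (x m) (x n) (y m) (y n))
       (subst (_ ℚ.≤_) (halves ε) (ℚ.+-mono-≤
         (hx m n (ℕ.m⊔n≤o⇒m≤o M N ≤m) (ℕ.m⊔n≤o⇒m≤o M N ≤n))
         (hy m n (ℕ.m⊔n≤o⇒n≤o M N ≤m) (ℕ.m⊔n≤o⇒n≤o M N ≤n))))

-_ : ℝ → ℝ
- mkℝ x cx = mkℝ (λ n → ℚ.- x n) λ ε 0<ε →
  let N , h = cx ε 0<ε
  in N , λ m n ≤m ≤n → subst (ℚ._≤ ε) (sym (neg-dist (x m) (x n))) (h m n ≤m ≤n)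

_-_ : ℝ → ℝ → ℝ
x - y = x + (- y)

∣_∣ : ℝ → ℝ
∣ mkℝ x cx ∣ = mkℝ (λ n → ℚ.∣ x n ∣) λ ε 0<ε →
  let N , h = cx ε 0<ε
  in N , λ m n ≤m ≤n → ℚ.≤-trans (abs-dist (x m) (x n)) (h m n ≤m ≤n)

_*_ : ℝ → ℝ → ℝ
mkℝ x cx * mkℝ y cy = mkℝ (λ n → x n ℚ.* y n) λ ε 0<ε →
  let A , 0<A , K , hA = bounded cx
      B , 0<B , L , hB = bounded cy
      α , 0<α , Bα = scale B (½ ℚ.* ε) 0<B (half 0<ε)
      β , 0<β , Aβ = scale A (½ ℚ.* ε) 0<A (half 0<ε)
      M , hx = cx α 0<α
      N , hy = cy β 0<β
      KL = K ℕ.⊔ L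
      MN = M ℕ.⊔ N
  in KL ℕ.⊔ MN , λ m n ≤m ≤n →
     let KL≤m = ℕ.m⊔n≤o⇒m≤o KL MN ≤m
         KL≤n = ℕ.m⊔n≤o⇒m≤o KL MN ≤n
         MN≤m = ℕ.m⊔n≤o⇒n≤o KL MN ≤m
         MN≤n = ℕ.m⊔n≤o⇒n≤o KL MN ≤n
     in subst (_ ℚ.≤_) (trans (cong₂ ℚ._+_ Aβ Bα) (halves ε))
          (*-dist (x m) (x n) (y m) (y n)
            (hA m (ℕ.m⊔n≤o⇒m≤o K L KL≤m))
            (hB n (ℕ.m⊔n≤o⇒n≤o K L KL≤n))
            (hx m n (ℕ.m⊔n≤o⇒m≤o M N MN≤m) (ℕ.m⊔n≤o⇒m≤o M N MN≤n))
            (hy m n (ℕ.m⊔n≤o⇒n≤o M N MN≤m) (ℕ.m⊔n≤o⇒n≤o M N MN≤n)))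

pointwise⇒≈ : ∀ x y → (∀ n → seq x n ≡ seq y n) → x ≈ y
pointwise⇒≈ x y eq ε 0<ε = 0 , λ n _ → subst (ℚ._≤ ε)
  (sym (trans (cong (λ a → ℚ.∣ a ℚ.- seq y n ∣) (eq n)) (-‿self (seq y n)))) (ℚ.<⇒≤ 0<ε)

≈-sym : ∀ x y → x ≈ y → y ≈ x
≈-sym x y x≈y ε 0<ε with x≈y ε 0<ε
... | N , h = N , λ n N≤n → subst (ℚ._≤ ε) (∣-∣-sym (seq x n) (seq y n)) (h n N≤n)

≈-trans : ∀ x y z → x ≈ y → y ≈ z → x ≈ z
≈-trans x y z x≈y y≈z ε 0<ε = both
  (λ n p q → ℚ.≤-trans (triangle (seq x n) (seq y n) (seq z n))
    (subst (_ ℚ.≤_) (halves ε) (ℚ.+-mono-≤ p q)))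
  (x≈y (½ ℚ.* ε) (half 0<ε)) (y≈z (½ ℚ.* ε) (half 0<ε))

+-cong : ∀ x x′ y y′ → x ≈ x′ → y ≈ y′ → x + y ≈ x′ + y′
+-cong x x′ y y′ p q ε 0<ε = both
  (λ n p q → ℚ.≤-trans (+-dist (seq x n) (seq x′ n) (seq y n) (seq y′ n))
    (subst (_ ℚ.≤_) (halves ε) (ℚ.+-mono-≤ p q)))
  (p (½ ℚ.* ε) (half 0<ε)) (q (½ ℚ.* ε) (half 0<ε))

-‿cong : ∀ x y → x ≈ y → - x ≈ - y
-‿cong x y p ε 0<ε with p ε 0<ε
... | N , h = N , λ n N≤n →
  subst (ℚ._≤ ε) (sym (neg-dist (seq x n) (seq y n))) (h n N≤n)

*-cong : ∀ x x′ y y′ → x ≈ x′ → y ≈ y′ → x * y ≈ x′ * y′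
*-cong x x′ y y′ p q ε 0<ε =
  let A , 0<A , hA = bounded (cauchy x)
      B , 0<B , hB = bounded (cauchy y′)
      α , 0<α , Bα = scale B (½ ℚ.* ε) 0<B (half 0<ε)
      β , 0<β , Aβ = scale A (½ ℚ.* ε) 0<A (half 0<ε)
  in both
    (λ { n (a , b) (p , q) → subst (_ ℚ.≤_) (trans (cong₂ ℚ._+_ Aβ Bα) (halves ε))
      (*-dist (seq x n) (seq x′ n) (seq y n) (seq y′ n) a b p q) })
    (both (λ _ → _,_) hA hB)
    (both (λ _ → _,_) (p α 0<α) (q β 0<β))

ℝ-commutativeRing : CommutativeRing 0ℓ 0ℓ
ℝ-commutativeRing = record
  { Carrier = ℝ
  ; _≈_ = _≈_
  ; _+_ = _+_
  ; _*_ = _*_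
  ; -_ = -_
  ; 0# = 0ℝ
  ; 1# = 1ℝ
  ; isCommutativeRing = record
    { isRing = record
      { +-isAbelianGroup = record
        { isGroup = record
          { isMonoid = record
            { isSemigroup = record
              { isMagma = record
                { isEquivalence = record
                  { refl = λ {x} → pointwise⇒≈ x x λ _ → refl
                  ; sym = λ {x y} → ≈-sym x y
                  ; trans = λ {x y z} → ≈-trans x y z
                  }
                ; ∙-cong = λ {x x′ y y′} → +-cong x x′ y y′
                }
              ; assoc = λ x y z → pointwise⇒≈ (x + y + z) (x + (y + z))
                  λ n → ℚ.+-assoc (seq x n) (seq y n) (seq z n)
              }
            ; identity = (λ x → pointwise⇒≈ (0ℝ + x) x λ n → ℚ.+-identityˡ (seq x n))
                       , (λ x → pointwise⇒≈ (x + 0ℝ) x λ n → ℚ.+-identityʳ (seq x n))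
            }
          ; inverse = (λ x → pointwise⇒≈ (- x + x) 0ℝ λ n → ℚ.+-inverseˡ (seq x n))
                    , (λ x → pointwise⇒≈ (x - x) 0ℝ λ n → ℚ.+-inverseʳ (seq x n))
          ; ⁻¹-cong = λ {x y} → -‿cong x y
          }
        ; comm = λ x y → pointwise⇒≈ (x + y) (y + x) λ n → ℚ.+-comm (seq x n) (seq y n)
        }
      ; *-cong = λ {x x′ y y′} → *-cong x x′ y y′
      ; *-assoc = λ x y z → pointwise⇒≈ (x * y * z) (x * (y * z))
          λ n → ℚ.*-assoc (seq x n) (seq y n) (seq z n)
      ; *-identity = (λ x → pointwise⇒≈ (1ℝ * x) x λ n → ℚ.*-identityˡ (seq x n))
                   , (λ x → pointwise⇒≈ (x * 1ℝ) x λ n → ℚ.*-identityʳ (seq x n))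
      ; distrib = (λ x y z → pointwise⇒≈ (x * (y + z)) (x * y + x * z)
                     λ n → ℚ.*-distribˡ-+ (seq x n) (seq y n) (seq z n))
                , (λ x y z → pointwise⇒≈ ((y + z) * x) (y * x + z * x)
                     λ n → ℚ.*-distribʳ-+ (seq x n) (seq y n) (seq z n))
      }
    ; *-comm = λ x y → pointwise⇒≈ (x * y) (y * x) λ n → ℚ.*-comm (seq x n) (seq y n)
    }
  }

∏ : ∀ {n} → Vector ℝ n → ℝ
∏ = RawMonoidDefinitions.sum (CommutativeRing.*-rawMonoid ℝ-commutativeRing)

∑ : List ℝ → ℝ
∑ = List.foldr _+_ 0ℝ

-- Rational ε suffice, since every positive real exceeds a positive rational.
TendsToZero : (ℕ → ℝ) → Set
TendsToZero p = ∀ ε → 0ℚ ℚ.< ε → Eventually λ n → ∣ p n ∣ ≤ fromℚ ε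

subsets : ∀ n → List (Subset n)
subsets zero    = [] ∷ []
subsets (suc n) = List.map (inside ∷_) (subsets n) ++ List.map (outside ∷_) (subsets n)

-- The probability that the random subset is exactly R.
ℙ : ∀ {n} → ℝ → Subset n → ℝ
ℙ p R = ∏ λ a → if lookup R a then p else 1ℝ - p

𝔼 : ∀ {n} → ℝ → (Subset n → ℝ) → ℝ
𝔼 {n} p X = ∑ (List.map (λ R → ℙ p R * X R) (subsets n))

infixl 6 _⊕_

_⊕_ : ∀ {n} .{{_ : NonZero n}} → Fin n → Fin n → Fin n
_⊕_ {n} a b = (toℕ a ℕ.+ toℕ b) mod n

toℕ-mod : ∀ m n .{{_ : NonZero n}} → toℕ (m mod n) ≡ m % n
toℕ-mod m n = Fin.toℕ-fromℕ< (m%n<n m n)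

toℕ-% : ∀ {n} .{{_ : NonZero n}} (a : Fin n) → toℕ a % n ≡ toℕ a
toℕ-% a = m<n⇒m%n≡m (Fin.toℕ<n a)

%-+ˡ : ∀ a b n .{{_ : NonZero n}} → (a % n ℕ.+ b) % n ≡ (a ℕ.+ b) % n
%-+ˡ a b n = trans (%-distribˡ-+ (a % n) b n)
  (trans (cong (λ c → (c ℕ.+ b % n) % n) (m%n%n≡m%n a n)) (sym (%-distribˡ-+ a b n)))

%-+ʳ : ∀ a b n .{{_ : NonZero n}} → (a ℕ.+ b % n) % n ≡ (a ℕ.+ b) % n
%-+ʳ a b n = trans (cong (_% n) (ℕ.+-comm a (b % n)))
  (trans (%-+ˡ b a n) (cong (_% n) (ℕ.+-comm b a)))

module _ {n : ℕ} .{{_ : NonZero n}} where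

  open ≡-Reasoning

  ⊕-comm : ∀ (a b : Fin n) → a ⊕ b ≡ b ⊕ a
  ⊕-comm a b = cong (_mod n) (ℕ.+-comm (toℕ a) (toℕ b))

  ⊕-assoc : ∀ (a b c : Fin n) → (a ⊕ b) ⊕ c ≡ a ⊕ (b ⊕ c)
  ⊕-assoc a b c = Fin.toℕ-injective (begin
    toℕ ((a ⊕ b) ⊕ c)                          ≡⟨ toℕ-mod _ n ⟩
    (toℕ (a ⊕ b) ℕ.+ toℕ c) % n                ≡⟨ cong (λ d → (d ℕ.+ toℕ c) % n) (toℕ-mod _ n) ⟩
    ((toℕ a ℕ.+ toℕ b) % n ℕ.+ toℕ c) % n      ≡⟨ %-+ˡ (toℕ a ℕ.+ toℕ b) (toℕ c) n ⟩
    (toℕ a ℕ.+ toℕ b ℕ.+ toℕ c) % n            ≡⟨ cong (_% n) (ℕ.+-assoc (toℕ a) (toℕ b) (toℕ c)) ⟩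
    (toℕ a ℕ.+ (toℕ b ℕ.+ toℕ c)) % n          ≡⟨ %-+ʳ (toℕ a) (toℕ b ℕ.+ toℕ c) n ⟨
    (toℕ a ℕ.+ (toℕ b ℕ.+ toℕ c) % n) % n      ≡⟨ cong (λ d → (toℕ a ℕ.+ d) % n) (toℕ-mod _ n) ⟨
    (toℕ a ℕ.+ toℕ (b ⊕ c)) % n                ≡⟨ toℕ-mod _ n ⟨
    toℕ (a ⊕ (b ⊕ c))                          ∎)

  ⊕-identityˡ : ∀ (a : Fin n) → (0 mod n) ⊕ a ≡ a
  ⊕-identityˡ a = Fin.toℕ-injective (begin
    toℕ ((0 mod n) ⊕ a)               ≡⟨ toℕ-mod _ n ⟩
    (toℕ (0 mod n) ℕ.+ toℕ a) % n     ≡⟨ cong (λ d → (d ℕ.+ toℕ a) % n) (toℕ-mod 0 n) ⟩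
    (0 % n ℕ.+ toℕ a) % n             ≡⟨ %-+ˡ 0 (toℕ a) n ⟩
    toℕ a % n                         ≡⟨ toℕ-% a ⟩
    toℕ a                             ∎)

  ⊖_ : Fin n → Fin n
  ⊖ a = (n ℕ.∸ toℕ a) mod n

  ⊖-inverseˡ : ∀ a → (⊖ a) ⊕ a ≡ 0 mod n
  ⊖-inverseˡ a = Fin.toℕ-injective (begin
    toℕ ((⊖ a) ⊕ a)                          ≡⟨ toℕ-mod _ n ⟩
    (toℕ (⊖ a) ℕ.+ toℕ a) % n                ≡⟨ cong (λ d → (d ℕ.+ toℕ a) % n) (toℕ-mod _ n) ⟩
    ((n ℕ.∸ toℕ a) % n ℕ.+ toℕ a) % n        ≡⟨ %-+ˡ (n ℕ.∸ toℕ a) (toℕ a) n ⟩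
    (n ℕ.∸ toℕ a ℕ.+ toℕ a) % n              ≡⟨ cong (_% n) (ℕ.m∸n+n≡m (ℕ.<⇒≤ (Fin.toℕ<n a))) ⟩
    n % n                                    ≡⟨ n%n≡0 n ⟩
    0                                        ≡⟨ m*n%n≡0 0 n ⟨
    0 % n                                    ≡⟨ toℕ-mod 0 n ⟨
    toℕ (0 mod n)                            ∎)

  ⊕-isAbelianGroup : IsAbelianGroup _≡_ _⊕_ (0 mod n) ⊖_
  ⊕-isAbelianGroup = record
    { isGroup = record
      { isMonoid = record
        { isSemigroup = record
          { isMagma = record { isEquivalence = isEquivalence ; ∙-cong = cong₂ _⊕_ }
          ; assoc = ⊕-assoc
          }
        ; identity = ⊕-identityˡ , λ a → trans (⊕-comm a (0 mod n)) (⊕-identityˡ a)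
        }
      ; inverse = ⊖-inverseˡ , λ a → trans (⊕-comm a (⊖ a)) (⊖-inverseˡ a)
      ; ⁻¹-cong = cong ⊖_
      }
    ; comm = ⊕-comm
    }

C : ∀ n → .{{NonZero n}} → AbelianGroup 0ℓ 0ℓ
C n = record { isAbelianGroup = ⊕-isAbelianGroup {n} }

module _ {n : ℕ} .{{_ : NonZero n}} where

  open RawMonoidDefinitions (AbelianGroup.rawMonoid (C n)) public
    using () renaming (_×_ to _·_; sum to ⨁)

  toℕ-· : ∀ m (g : Fin n) → toℕ (m · g) ≡ (m ℕ.* toℕ g) % n
  toℕ-· zero    g = toℕ-mod 0 n
  toℕ-· (suc m) g = trans (toℕ-mod _ n)
    (trans (cong (λ d → (toℕ g ℕ.+ d) % n) (toℕ-· m g)) (%-+ʳ (toℕ g) (m ℕ.* toℕ g) n))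

  -- Since C n is finite, ℕ-multiples of g exhaust the subgroup it generates.
  IsGenerator : Fin n → Set
  IsGenerator g = ∀ a → ∃ λ m → m · g ≡ a

  %-· : ∀ m (g : Fin n) → (m % n) · g ≡ m · g
  %-· m g = Fin.toℕ-injective (begin
    toℕ ((m % n) · g)                ≡⟨ toℕ-· (m % n) g ⟩
    (m % n ℕ.* toℕ g) % n            ≡⟨ cong (λ d → (m % n ℕ.* d) % n) (toℕ-% g) ⟨
    (m % n ℕ.* (toℕ g % n)) % n      ≡⟨ %-distribˡ-* m (toℕ g) n ⟨
    (m ℕ.* toℕ g) % n                ≡⟨ toℕ-· m g ⟨
    toℕ (m · g)                      ∎)
    where open ≡-Reasoning

  isGenerator? : ∀ g → Dec (IsGenerator g)
  isGenerator? g = Fin.all? λ a → map′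
    (λ { (m , _ , eq) → m , eq })
    (λ { (m , eq) → m % n , m%n<n m n , trans (%-· m g) eq })
    (ℕ.anyUpTo? (λ m → m · g Fin.≟ a) n)

φ : ∀ n → .{{NonZero n}} → ℕ
φ n = List.length (filter isGenerator? (allFin n))

-- lookup S a is the multiplicity of a in S.
Sequence : ℕ → Set
Sequence n = Vec ℕ n

∥_∥ : ∀ {n} → Sequence n → ℕ
∥ S ∥ = Vec.sum S

infix 4 _⊑_

_⊑_ : ∀ {n} → Sequence n → Sequence n → Set
T ⊑ S = ∀ a → lookup T a ℕ.≤ lookup S a

_ContainedIn_ : ∀ {n} → Sequence n → Subset n → Set
S ContainedIn A = ∀ a → 0 ℕ.< lookup S a → a ∈ A

module _ {n : ℕ} .{{_ : NonZero n}} where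

  σ : Sequence n → Fin n
  σ S = ⨁ λ a → lookup S a · a

  ZeroSum : Sequence n → Set
  ZeroSum S = σ S ≡ 0 mod n

  ZeroSumFree : Sequence n → Set
  ZeroSumFree S = ¬ ∃ λ T → T ⊑ S × 0 ℕ.< ∥ T ∥ × ZeroSum T

any⊑? : ∀ {n} {P : Sequence n → Set} → (∀ T → Dec (P T)) →
        ∀ S → Dec (∃ λ T → T ⊑ S × P T)
any⊑? P? []      = map′ (λ p → [] , (λ ()) , p) (λ { ([] , _ , p) → p }) (P? [])
any⊑? P? (s ∷ S) = map′
  (λ { (t , ℕ.s≤s t≤s , T , T⊑S , p) →
       t ∷ T , (λ { zero → t≤s ; (suc a) → T⊑S a }) , p })
  (λ { (t ∷ T , le , p) → t , ℕ.s≤s (le zero) , T , (λ a → le (suc a)) , p })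
  (ℕ.anyUpTo? (λ t → any⊑? (λ T → P? (t ∷ T)) S) (suc s))

zeroSumFree? : ∀ {n} .{{_ : NonZero n}} (S : Sequence n) → Dec (ZeroSumFree S)
zeroSumFree? S = ¬? (any⊑? (λ T → 0 ℕ.<? ∥ T ∥ ×-dec σ T Fin.≟ _) S)

containedIn? : ∀ {n} (A : Subset n) (S : Sequence n) → Dec (S ContainedIn A)
containedIn? A S = Fin.all? λ a → 0 ℕ.<? lookup S a →-dec a ∈? A

increment : ∀ {n} → Sequence (suc n) → Sequence (suc n)
increment (m ∷ S) = suc m ∷ S

-- All sequences of length ℓ, each listed once: see sequences-complete,
-- sequences-sound and sequences-unique.
sequences : ∀ n (ℓ : ℕ) → List (Sequence n)
sequences zero    zero    = [] ∷ []
sequences zero    (suc ℓ) = []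
sequences (suc n) zero    = List.map (0 ∷_) (sequences n zero)
sequences (suc n) (suc ℓ) =
  List.map (0 ∷_) (sequences n (suc ℓ)) ++ List.map increment (sequences (suc n) ℓ)

sequences-complete : ∀ {n} (S : Sequence n) → S ∈ˡ sequences n ∥ S ∥
sequences-complete []      = here refl
sequences-complete (m ∷ S) = go m
  where
    0∷S : ∀ ℓ → S ∈ˡ sequences _ ℓ → (0 ∷ S) ∈ˡ sequences _ ℓ
    0∷S zero    S∈ = ∈-map⁺ (0 ∷_) S∈
    0∷S (suc ℓ) S∈ = ∈-++⁺ˡ (∈-map⁺ (0 ∷_) S∈)

    go : ∀ m → (m ∷ S) ∈ˡ sequences _ (m ℕ.+ ∥ S ∥)
    go zero    = 0∷S ∥ S ∥ (sequences-complete S)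
    go (suc m) = ∈-++⁺ʳ _ (∈-map⁺ increment (go m))

sequences-sound : ∀ n ℓ {S : Sequence n} → S ∈ˡ sequences n ℓ → ∥ S ∥ ≡ ℓ
sequences-sound zero    zero    (here refl) = refl
sequences-sound (suc n) zero    S∈ with ∈-map⁻ (0 ∷_) S∈
... | _ , T∈ , refl = sequences-sound n zero T∈
sequences-sound (suc n) (suc ℓ) S∈ with ∈-++⁻ (List.map (0 ∷_) (sequences n (suc ℓ))) S∈
... | inj₁ S∈₀ with ∈-map⁻ (0 ∷_) S∈₀
...   | _ , T∈ , refl = sequences-sound n (suc ℓ) T∈
sequences-sound (suc n) (suc ℓ) S∈ | inj₂ S∈₁ with ∈-map⁻ increment S∈₁
...   | _ ∷ _ , T∈ , refl = cong suc (sequences-sound (suc n) ℓ T∈)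

sequences-unique : ∀ n ℓ → Unique (sequences n ℓ)
sequences-unique zero    zero    = [] ∷ []
sequences-unique zero    (suc ℓ) = []
sequences-unique (suc n) zero    = Unique.map⁺ Vec.∷-injectiveʳ (sequences-unique n zero)
sequences-unique (suc n) (suc ℓ) = Unique.++⁺
  (Unique.map⁺ Vec.∷-injectiveʳ (sequences-unique n (suc ℓ)))
  (Unique.map⁺ increment-injective (sequences-unique (suc n) ℓ))
  disjoint
  where
    increment-injective : ∀ {S T : Sequence (suc n)} → increment S ≡ increment T → S ≡ T
    increment-injective {_ ∷ _} {_ ∷ _} refl = refl

    disjoint : ∀ {S} → ¬ (S ∈ˡ List.map (0 ∷_) (sequences n (suc ℓ)) ×
                          S ∈ˡ List.map increment (sequences (suc n) ℓ))
    disjoint (S∈₀ , S∈₁) with ∈-map⁻ (0 ∷_) S∈₀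
    ... | _ , _ , refl with ∈-map⁻ increment S∈₁
    ...   | _ ∷ _ , _ , ()

N : ∀ {n} .{{_ : NonZero n}} → Subset n → ℕ → ℕ
N {n} R ℓ = List.length
  (filter (λ S → zeroSumFree? S ×-dec containedIn? R S) (sequences n ℓ))

{-# OPTIONS --safe #-}
module Submission where

-- Each zero-sum free S ⊂ C n is contained in R with probability p ^ |supp S|, so the expectation is
-- the sum of p ^ |supp S| over all zero-sum free S of length n - 1 - k.
--
-- By the Boyer–Moore majority vote, S consists of copies of one element g and of t pairs of distinct
-- elements.  In a zero-sum free sequence the numbers of nonempty subset sums of disjoint parts add up
-- to at most that of the whole (Scherk); a copy of g contributes 1 and a pair contributes 3, hence
-- |S| + t ≤ n - 1 and t ≤ k.  So S has at least c = n - 1 - 3k copies of g.  For n ≤ 2c this forces g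
-- to generate C n, and an element x·g of S has x ≤ 3k, since otherwise n - x copies of g complete it
-- to a zero-sum.  Thus there are at most (3k + 1) ^ (2k) such S for each generator g.  Exactly one per
-- generator, the constant one, has support of size 1; all others contribute to the error term.

open import Algebra.Bundles using (AbelianGroup; CommutativeRing; Semiring)
import Algebra.Definitions.RawSemiring as RawSemiringDefinitions
import Algebra.Properties.AbelianGroup as AbelianGroupProperties
import Algebra.Properties.CommutativeMonoid.Sum as CommutativeMonoidSum
import Algebra.Properties.Monoid.Mult as MonoidMult
open import Data.Bool using (true; false; if_then_else_)
open import Data.Fin as Fin using (Fin; zero; suc; toℕ)
import Data.Fin.Properties as Fin
open import Data.Fin.Subset using (Subset; inside; outside)
import Data.Fin.Subset.Properties as Subset
import Data.Integer as ℤ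
import Data.Integer.Properties as ℤ
open import Data.List as List
  using (List; []; _∷_; _++_; length; map; filter; replicate; allFin; upTo; cartesianProductWith)
import Data.List.Properties as List
open import Data.List.Membership.Propositional using (_∈_; find; lose)
open import Data.List.Membership.Propositional.Properties
open import Data.List.Relation.Unary.All as All using (All; []; _∷_)
import Data.List.Relation.Unary.All.Properties as All
open import Data.List.Relation.Unary.AllPairs using ([]; _∷_)
open import Data.List.Relation.Unary.Any as Any using (here; there)
open import Data.List.Relation.Unary.Unique.Propositional using (Unique)
import Data.List.Relation.Unary.Unique.Propositional.Properties as Unique
open import Data.Nat as ℕ using (ℕ; zero; suc; NonZero; _∸_; z≤n; s≤s)
open import Data.Nat.DivMod using (_%_; _mod_; m%n<n; m*n%n≡0; m<n⇒m%n≡m; %-distribˡ-*)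
open import Data.Nat.Induction using (<-wellFounded; Acc; acc)
import Data.Nat.Properties as ℕ
open import Data.Nat.Solver using (module +-*-Solver)
open import Data.Product using (∃; ∃₂; _×_; _,_; proj₁; proj₂)
open import Data.Rational as ℚ using (ℚ; 0ℚ; 1ℚ; ½)
import Data.Rational.Properties as ℚ
open import Data.Rational.Solver renaming (module +-*-Solver to ℚ-Solver)
import Data.Rational.Unnormalised as ℚᵘ
import Data.Rational.Unnormalised.Properties as ℚᵘ
open import Data.Sum using (inj₁; inj₂)
open import Data.Vec as Vec using (Vec; []; _∷_; lookup; _[_]≔_; zipWith)
import Data.Vec.Properties as Vec
open import Data.Vec.Functional using (Vector)
open import Function using (_∘_; id; case_of_)
open import Relation.Binary.PropositionalEquality
open import Relation.Nullary using (¬_; Dec; does; yes; no; contradiction; ¬?)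
open import Relation.Nullary.Decidable using (_×-dec_)
open import Relation.Unary using (Decidable)
open import Defs

-- Cardinalities of lists without repetition

-- Pigeonhole, the source of every cardinality comparison below. One occurrence of the head is cut
-- out of `ys`, and uniqueness of `xs` keeps the tail inside what remains.
length-⊆ : ∀ {A : Set} {xs ys : List A} → Unique xs → (∀ {x} → x ∈ xs → x ∈ ys) → length xs ℕ.≤ length ys
length-⊆ {xs = []}     {ys} _        _     = z≤n
length-⊆ {xs = x ∷ xs} {ys} (x∉xs ∷ u) xs⊆ys with ∈-∃++ (xs⊆ys (here refl))
... | as , bs , refl = begin
  suc (length xs)                ≤⟨ s≤s (length-⊆ u strip) ⟩
  suc (length (as ++ bs))        ≡⟨ cong suc (List.length-++ as) ⟩
  suc (length as ℕ.+ length bs)  ≡⟨ ℕ.+-suc (length as) (length bs) ⟨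
  length as ℕ.+ suc (length bs)  ≡⟨ List.length-++ as ⟨
  length (as ++ x ∷ bs)          ∎
  where
    open ℕ.≤-Reasoning
    strip : ∀ {y} → y ∈ xs → y ∈ as ++ bs
    strip y∈ with ∈-++⁻ as (xs⊆ys (there y∈))
    ... | inj₁ y∈as         = ∈-++⁺ˡ y∈as
    ... | inj₂ (here refl)  = contradiction refl (All.lookup x∉xs y∈)
    ... | inj₂ (there y∈bs) = ∈-++⁺ʳ as y∈bs

length-unique : ∀ {n} {xs : List (Fin n)} → Unique xs → length xs ℕ.≤ n
length-unique {n} {xs} u = subst (length xs ℕ.≤_) (List.length-tabulate {n = n} id)
  (length-⊆ u (λ {x} _ → ∈-allFin x))

length-filter-∁ : ∀ {A : Set} {P : A → Set} (P? : Decidable P) xs →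
  length (filter P? xs) ℕ.+ length (filter (¬? ∘ P?) xs) ≡ length xs
length-filter-∁ P? []       = refl
length-filter-∁ P? (x ∷ xs) with P? x
... | yes _ = cong suc (length-filter-∁ P? xs)
... | no  _ = trans (ℕ.+-suc _ _) (cong suc (length-filter-∁ P? xs))

-- Sequences as multisets under addition

infixl 6 _⊞_

_⊞_ : ∀ {n} → Sequence n → Sequence n → Sequence n
_⊞_ = zipWith ℕ._+_

𝟘 : ∀ {n} → Sequence n
𝟘 = Vec.replicate _ 0

single : ∀ {n} → Fin n → Sequence n
single a = 𝟘 [ a ]≔ 1

-- A multiplicity vector has no first element to recurse on, so arguments that treat a sequence
-- element by element pass through a list whose order is then forgotten.
bag : ∀ {n} → List (Fin n) → Sequence n
bag []       = 𝟘
bag (a ∷ xs) = single a ⊞ bag xs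

module _ {n : ℕ} where

  ⊞-comm : ∀ (S T : Sequence n) → S ⊞ T ≡ T ⊞ S
  ⊞-comm = Vec.zipWith-comm ℕ.+-comm

  ⊞-assoc : ∀ (S T U : Sequence n) → (S ⊞ T) ⊞ U ≡ S ⊞ (T ⊞ U)
  ⊞-assoc = Vec.zipWith-assoc ℕ.+-assoc

  ⊞-identityˡ : ∀ (S : Sequence n) → 𝟘 ⊞ S ≡ S
  ⊞-identityˡ = Vec.zipWith-identityˡ ℕ.+-identityˡ

  ⊞-swap : ∀ (S T U : Sequence n) → S ⊞ (T ⊞ U) ≡ T ⊞ (S ⊞ U)
  ⊞-swap S T U = trans (sym (⊞-assoc S T U)) (trans (cong (_⊞ U) (⊞-comm S T)) (⊞-assoc T S U))

  bag-++ : ∀ (xs ys : List (Fin n)) → bag (xs ++ ys) ≡ bag xs ⊞ bag ys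
  bag-++ []       ys = sym (⊞-identityˡ _)
  bag-++ (x ∷ xs) ys = trans (cong (single x ⊞_) (bag-++ xs ys)) (sym (⊞-assoc _ _ _))

  lookup-⊞ : ∀ (S T : Sequence n) a → lookup (S ⊞ T) a ≡ lookup S a ℕ.+ lookup T a
  lookup-⊞ S T a = Vec.lookup-zipWith ℕ._+_ a S T

  lookup-𝟘 : ∀ (a : Fin n) → lookup 𝟘 a ≡ 0
  lookup-𝟘 a = Vec.lookup-replicate a 0

  lookup-single : ∀ (a : Fin n) → lookup (single a) a ≡ 1
  lookup-single a = Vec.lookup∘update a 𝟘 1

  lookup-single′ : ∀ {a b : Fin n} → a ≢ b → lookup (single b) a ≡ 0
  lookup-single′ {a} a≢b = trans (Vec.lookup∘update′ a≢b 𝟘 1) (lookup-𝟘 a)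

  lookup-replicate : ∀ c (a : Fin n) → lookup (bag (replicate c a)) a ≡ c
  lookup-replicate zero    a = lookup-𝟘 a
  lookup-replicate (suc c) a = trans (lookup-⊞ (single a) _ a)
    (cong₂ ℕ._+_ (lookup-single a) (lookup-replicate c a))

  lookup-replicate′ : ∀ c {a b : Fin n} → a ≢ b → lookup (bag (replicate c b)) a ≡ 0
  lookup-replicate′ zero    {a} a≢b = lookup-𝟘 a
  lookup-replicate′ (suc c) {a} {b} a≢b = trans (lookup-⊞ (single b) _ a)
    (cong₂ ℕ._+_ (lookup-single′ a≢b) (lookup-replicate′ c a≢b))

  lookup-ext : ∀ {S T : Sequence n} → (∀ a → lookup S a ≡ lookup T a) → S ≡ T
  lookup-ext {S} {T} eq = trans (sym (Vec.tabulate∘lookup S)) (trans (Vec.tabulate-cong eq) (Vec.tabulate∘lookup T))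

  ⊑-trans : ∀ (S T U : Sequence n) → S ⊑ T → T ⊑ U → S ⊑ U
  ⊑-trans S T U S⊑T T⊑U a = ℕ.≤-trans (S⊑T a) (T⊑U a)

  ⊑-⊞ˡ : ∀ (S T : Sequence n) → S ⊑ S ⊞ T
  ⊑-⊞ˡ S T a = subst (lookup S a ℕ.≤_) (sym (lookup-⊞ S T a)) (ℕ.m≤m+n _ _)

  ⊑-⊞ʳ : ∀ (S T : Sequence n) → T ⊑ S ⊞ T
  ⊑-⊞ʳ S T a = subst (lookup T a ℕ.≤_) (sym (lookup-⊞ S T a)) (ℕ.m≤n+m _ _)

  ⊞-mono : ∀ (S T U V : Sequence n) → S ⊑ T → U ⊑ V → S ⊞ U ⊑ T ⊞ V
  ⊞-mono S T U V p q a =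
    subst₂ ℕ._≤_ (sym (lookup-⊞ S U a)) (sym (lookup-⊞ T V a)) (ℕ.+-mono-≤ (p a) (q a))

  𝟘-⊑ : ∀ (S : Sequence n) → 𝟘 ⊑ S
  𝟘-⊑ S a = subst (ℕ._≤ lookup S a) (sym (lookup-𝟘 a)) z≤n

∥⊞∥ : ∀ {n} (S T : Sequence n) → ∥ S ⊞ T ∥ ≡ ∥ S ∥ ℕ.+ ∥ T ∥
∥⊞∥ []      []      = refl
∥⊞∥ (s ∷ S) (t ∷ T) = trans (cong (s ℕ.+ t ℕ.+_) (∥⊞∥ S T))
  (solve 4 (λ a b c d → (a :+ b) :+ (c :+ d) := (a :+ c) :+ (b :+ d)) refl s t ∥ S ∥ ∥ T ∥)
  where open +-*-Solver

∥𝟘∥ : ∀ n → ∥ 𝟘 {n} ∥ ≡ 0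
∥𝟘∥ zero    = refl
∥𝟘∥ (suc n) = ∥𝟘∥ n

∥single∥ : ∀ {n} (a : Fin n) → ∥ single a ∥ ≡ 1
∥single∥ {suc n} zero    = cong suc (∥𝟘∥ n)
∥single∥ {suc n} (suc a) = ∥single∥ a

∥bag∥ : ∀ {n} (xs : List (Fin n)) → ∥ bag xs ∥ ≡ length xs
∥bag∥ {n} [] = ∥𝟘∥ n
∥bag∥ (x ∷ xs) = trans (∥⊞∥ (single x) (bag xs)) (cong₂ ℕ._+_ (∥single∥ x) (∥bag∥ xs))

∥∥≡0⇒≡𝟘 : ∀ {n} (S : Sequence n) → ∥ S ∥ ≡ 0 → S ≡ 𝟘
∥∥≡0⇒≡𝟘 []      _ = refl
∥∥≡0⇒≡𝟘 (zero ∷ S) eq = cong (0 ∷_) (∥∥≡0⇒≡𝟘 S eq)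

bag-surjective : ∀ {n} (S : Sequence n) → ∃ λ xs → S ≡ bag xs
bag-surjective []      = [] , refl
bag-surjective (m ∷ S) = go m
  where
    shift : ∀ {n} (xs : List (Fin n)) → 0 ∷ bag xs ≡ bag (map suc xs)
    shift []       = refl
    shift (x ∷ xs) = cong (single (suc x) ⊞_) (shift xs)

    go : ∀ m → ∃ λ xs → m ∷ S ≡ bag xs
    go zero with bag-surjective S
    ... | xs , refl = map suc xs , shift xs
    go (suc m) with go m
    ... | xs , eq = zero ∷ xs , trans (cong (suc m ∷_) (sym (⊞-identityˡ S))) (cong (single zero ⊞_) eq)

-- Sums of sequences in the cyclic group

module _ {n : ℕ} .{{_ : NonZero n}} where

  private
    module G = AbelianGroup (C n)
    module GP = AbelianGroupProperties (C n)
    module Sum = CommutativeMonoidSum G.commutativeMonoid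
    module Mult = MonoidMult G.monoid
    0# : Fin n
    0# = 0 mod n

  ∈?-dec : ∀ (a : Fin n) xs → Dec (a ∈ xs)
  ∈?-dec a = Any.any? (a Fin.≟_)

  ⨁-supported : ∀ {m} (t : Vector (Fin n) m) a → (∀ i → i ≢ a → t i ≡ 0#) → ⨁ t ≡ t a
  ⨁-supported {suc m} t zero h = trans
    (cong (t zero ⊕_) (trans (Sum.sum-cong-≗ (λ i → h (suc i) λ ())) (Sum.sum-replicate-zero m)))
    (G.identityʳ (t zero))
  ⨁-supported {suc m} t (suc a) h = trans
    (cong₂ _⊕_ (h zero λ ()) (⨁-supported (t ∘ suc) a λ i i≢a → h (suc i) (i≢a ∘ Fin.suc-injective)))
    (⊕-identityˡ _)

  σ-⊞ : ∀ (S T : Sequence n) → σ (S ⊞ T) ≡ σ S ⊕ σ T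
  σ-⊞ S T = trans
    (Sum.sum-cong-≗ λ a → trans (cong (_· a) (lookup-⊞ S T a)) (Mult.×-homo-+ a (lookup S a) (lookup T a)))
    (Sum.∑-distrib-+ (λ a → lookup S a · a) (λ a → lookup T a · a))

  σ-𝟘 : σ {n} 𝟘 ≡ 0#
  σ-𝟘 = trans (Sum.sum-cong-≗ λ a → cong (_· a) (lookup-𝟘 a)) (Sum.sum-replicate-zero n)

  σ-single : ∀ a → σ {n} (single a) ≡ a
  σ-single a = trans
    (⨁-supported (λ b → lookup (single a) b · b) a λ b b≢a → cong (_· b) (lookup-single′ b≢a))
    (trans (cong (_· a) (lookup-single a)) (G.identityʳ a))

  σ-replicate : ∀ c a → σ {n} (bag (replicate c a)) ≡ c · a
  σ-replicate zero    a = σ-𝟘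
  σ-replicate (suc c) a = trans (σ-⊞ (single a) _) (cong₂ _⊕_ (σ-single a) (σ-replicate c a))

  zeroSumFree-⊞ˡ : ∀ (S T : Sequence n) → ZeroSumFree (S ⊞ T) → ZeroSumFree S
  zeroSumFree-⊞ˡ S T free (U , U⊑S , rest) = free (U , ⊑-trans U S (S ⊞ T) U⊑S (⊑-⊞ˡ S T) , rest)

  zeroSumFree-⊞ʳ : ∀ (S T : Sequence n) → ZeroSumFree (S ⊞ T) → ZeroSumFree T
  zeroSumFree-⊞ʳ S T free (U , U⊑T , rest) = free (U , ⊑-trans U T (S ⊞ T) U⊑T (⊑-⊞ʳ S T) , rest)

  element≢0 : ∀ (S T : Sequence n) → ZeroSumFree S → T ⊑ S → 0 ℕ.< ∥ T ∥ → σ T ≢ 0#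
  element≢0 S T free T⊑S 0<T eq = free (T , T⊑S , 0<T , eq)

  zeroSum⇒𝟘 : ∀ (S T : Sequence n) → ZeroSumFree S → T ⊑ S → ZeroSum T → T ≡ 𝟘
  zeroSum⇒𝟘 S T free T⊑S zs with ∥ T ∥ ℕ.≟ 0
  ... | yes eq = ∥∥≡0⇒≡𝟘 T eq
  ... | no neq = contradiction zs (element≢0 S T free T⊑S (ℕ.n≢0⇒n>0 neq))

  n· : ∀ (a : Fin n) → n · a ≡ 0#
  n· a = Fin.toℕ-injective (trans (toℕ-· n a)
    (trans (cong (_% n) (ℕ.*-comm n (toℕ a))) (trans (m*n%n≡0 (toℕ a) n)
      (sym (trans (toℕ-mod 0 n) (m*n%n≡0 0 n))))))

  -- Scherk's theorem and subset sums of zero-sum free sequences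

  -- Starting from 0 and adding `b` repeatedly stays in `A`. After `n - 1` steps this reaches the
  -- inverse of `b`.
  closed⇒neg : ∀ {A : List (Fin n)} {b} → 0# ∈ A → (∀ {a} → a ∈ A → a ⊕ b ∈ A) → ∃ λ a → a ∈ A × a ⊕ b ≡ 0#
  closed⇒neg {A} {b} 0∈A closed = ℕ.pred n · b , multiples (ℕ.pred n) ,
    trans (⊕-comm _ b) (trans (cong (_· b) (ℕ.suc-pred n)) (n· b))
    where
      multiples : ∀ m → m · b ∈ A
      multiples zero    = 0∈A
      multiples (suc m) = subst (_∈ A) (⊕-comm (m · b) b) (closed (multiples m))

  -- Scherk's bound asks for at least |A| + |B| - 1 sums. Selecting a set `D` of exactly that many
  -- lets sizes be carried along as equations, and `0# ∈ D` lets `D` serve as a summand again.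
  Sums : List (Fin n) → List (Fin n) → Set
  Sums A B = ∃ λ D → Unique D × suc (length D) ≡ length A ℕ.+ length B × 0# ∈ D ×
    (∀ {d} → d ∈ D → ∃₂ λ a b → a ∈ A × b ∈ B × d ≡ a ⊕ b)

  -- Scherk's theorem.  If some e ∈ A and b ∈ B have e ⊕ b ∉ A, Dyson's e-transform moves
  -- those b from B into A as e ⊕ b, which keeps the sizes and adds no sums.
  sumset : ∀ {A B : List (Fin n)} → Unique A → Unique B → 0# ∈ A → 0# ∈ B →
    (∀ {a b} → a ∈ A → b ∈ B → a ⊕ b ≡ 0# → b ≡ 0#) →
    Sums A B
  sumset {B = B} = go (<-wellFounded (length B))
    where
    go : ∀ {A B : List (Fin n)} → Acc ℕ._<_ (length B) → Unique A → Unique B → 0# ∈ A → 0# ∈ B →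
      (∀ {a b} → a ∈ A → b ∈ B → a ⊕ b ≡ 0# → b ≡ 0#) →
      Sums A B
    go {A} {B} (acc rec) uA uB 0∈A 0∈B trivial
      with All.all? (λ e → All.all? (λ b → ∈?-dec (e ⊕ b) A) B) A
    ... | yes closed = A , uA , trans (ℕ.+-comm 1 (length A)) (cong (length A ℕ.+_) (sym ∣B∣≡1)) , 0∈A ,
            λ {d} d∈A → d , 0# , d∈A , 0∈B , sym (G.identityʳ d)
      where
        -- Here `A` is closed under adding any `b ∈ B`, so it contains the inverse of `b`, and the
        -- hypothesis on vanishing sums leaves only `b = 0`.
        B⊆0 : ∀ {b} → b ∈ B → b ∈ 0# ∷ []
        B⊆0 b∈B with closed⇒neg 0∈A (λ a∈A → All.lookup (All.lookup closed a∈A) b∈B)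
        ... | a , a∈A , eq = here (trivial a∈A b∈B eq)

        ∣B∣≡1 : length B ≡ 1
        ∣B∣≡1 = ℕ.≤-antisym (length-⊆ uB B⊆0) (length-⊆ ([] ∷ []) λ { (here refl) → 0∈B })
    ... | no ¬closed with find (All.¬All⇒Any¬ (λ e → All.all? (λ b → ∈?-dec (e ⊕ b) A) B) A ¬closed)
    ...   | e , e∈A , ¬e = combine
      (go {A′} {B₀} (rec (List.filter-notAll stays? B (All.¬All⇒Any¬ stays? B ¬e)))
        uA′ (Unique.filter⁺ stays? uB) (∈-++⁺ˡ 0∈A) 0∈B₀ trivial′)
      where
        stays? = λ b → ∈?-dec (e ⊕ b) A
        B₀ = filter stays? B
        B₁ = filter (¬? ∘ stays?) B
        A′ = A ++ map (e ⊕_) B₁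

        0∈B₀ : 0# ∈ B₀
        0∈B₀ = ∈-filter⁺ stays? 0∈B (subst (_∈ A) (sym (G.identityʳ e)) e∈A)

        uA′ : Unique A′
        uA′ = Unique.++⁺ uA
          (Unique.map⁺ (λ {x} {y} → GP.∙-cancelˡ e x y) (Unique.filter⁺ (¬? ∘ stays?) uB)) disjoint
          where
            disjoint : ∀ {x} → ¬ (x ∈ A × x ∈ map (e ⊕_) B₁)
            disjoint (x∈A , x∈) with ∈-map⁻ (e ⊕_) x∈
            ... | b , b∈ , refl = proj₂ (∈-filter⁻ (¬? ∘ stays?) {xs = B} b∈) x∈A

        -- A sum of a moved element `e ⊕ b′` and a staying `b` is also the sum of `e ⊕ b`, which
        -- lies in `A`, and `b′ ∈ B`. Hence the transform creates no new sums.
        swap : ∀ b b′ → (e ⊕ b′) ⊕ b ≡ (e ⊕ b) ⊕ b′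
        swap b b′ = trans (⊕-assoc e b′ b) (trans (cong (e ⊕_) (⊕-comm b′ b)) (sym (⊕-assoc e b b′)))

        sums : ∀ {a b} → a ∈ A′ → b ∈ B₀ → ∃₂ λ x y → x ∈ A × y ∈ B × a ⊕ b ≡ x ⊕ y
        sums {a} {b} a∈ b∈ with ∈-filter⁻ stays? {xs = B} b∈ | ∈-++⁻ A a∈
        ... | b∈B , _ | inj₁ a∈A = a , b , a∈A , b∈B , refl
        ... | b∈B , eb∈A | inj₂ a∈₁ with ∈-map⁻ (e ⊕_) a∈₁
        ...   | b′ , b′∈ , refl = e ⊕ b , b′ , eb∈A ,
                proj₁ (∈-filter⁻ (¬? ∘ stays?) {xs = B} b′∈) , swap b b′

        -- For a moved element the swapped sum `(e ⊕ b) ⊕ b′` vanishes, which forces `b′ = 0`. But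
        -- then `e ⊕ b′ = e` lies in `A`, and `b′` would have stayed in `B`.
        trivial′ : ∀ {a b} → a ∈ A′ → b ∈ B₀ → a ⊕ b ≡ 0# → b ≡ 0#
        trivial′ {a} {b} a∈ b∈ eq with ∈-filter⁻ stays? {xs = B} b∈ | ∈-++⁻ A a∈
        ... | b∈B , _ | inj₁ a∈A = trivial a∈A b∈B eq
        ... | b∈B , eb∈A | inj₂ a∈₁ with ∈-map⁻ (e ⊕_) a∈₁
        ...   | b′ , b′∈ , refl with ∈-filter⁻ (¬? ∘ stays?) {xs = B} b′∈
        ...     | b′∈B , eb′∉A = contradiction
                    (subst (λ c → e ⊕ c ∈ A) (sym (trivial eb∈A b′∈B (trans (sym (swap b b′)) eq)))
                      (subst (_∈ A) (sym (G.identityʳ e)) e∈A))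
                    eb′∉A

        sizes : length A′ ℕ.+ length B₀ ≡ length A ℕ.+ length B
        sizes = begin
          length A′ ℕ.+ length B₀                     ≡⟨ cong (ℕ._+ length B₀) (List.length-++ A) ⟩
          length A ℕ.+ length (map (e ⊕_) B₁) ℕ.+ length B₀
            ≡⟨ cong (λ l → length A ℕ.+ l ℕ.+ length B₀) (List.length-map (e ⊕_) B₁) ⟩
          length A ℕ.+ length B₁ ℕ.+ length B₀        ≡⟨ ℕ.+-assoc (length A) _ _ ⟩
          length A ℕ.+ (length B₁ ℕ.+ length B₀)      ≡⟨ cong (length A ℕ.+_) (ℕ.+-comm (length B₁) _) ⟩
          length A ℕ.+ (length B₀ ℕ.+ length B₁)      ≡⟨ cong (length A ℕ.+_) (length-filter-∁ stays? B) ⟩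
          length A ℕ.+ length B                       ∎
          where open ≡-Reasoning

        combine : Sums A′ B₀ → Sums A B
        combine (D , uD , ∣D∣ , 0∈D , ⊆) = D , uD , trans ∣D∣ sizes , 0∈D , λ {d} d∈ →
          let a , b , a∈ , b∈ , eq = ⊆ d∈
              x , y , x∈ , y∈ , eq′ = sums a∈ b∈
          in x , y , x∈ , y∈ , trans eq eq′

  -- The empty sum is not counted in l, which makes l additive in subsetSums-⊞.
  SubsetSums : Sequence n → ℕ → Set
  SubsetSums S l = ∃ λ D → Unique D × length D ≡ suc l × 0# ∈ D ×
    (∀ {d} → d ∈ D → ∃ λ T → T ⊑ S × σ T ≡ d)

  -- Zero-sum freeness supplies the hypothesis of `sumset`: cancelling sums come from a zero-sum
  -- `U ⊞ V` inside `S ⊞ T`, which must be empty, so `V` is empty and its sum is 0.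
  subsetSums-⊞ : ∀ S T {l m} → ZeroSumFree (S ⊞ T) →
    SubsetSums S l → SubsetSums T m → SubsetSums (S ⊞ T) (l ℕ.+ m)
  subsetSums-⊞ S T {l} {m} free (A , uA , ∣A∣ , 0∈A , sumsA) (B , uB , ∣B∣ , 0∈B , sumsB) =
    let D , uD , ∣D∣ , 0∈D , sums = sumset uA uB 0∈A 0∈B trivial
    in D , uD ,
       ℕ.suc-injective (trans ∣D∣ (trans (cong₂ ℕ._+_ ∣A∣ ∣B∣) (cong suc (ℕ.+-suc l m)))) , 0∈D ,
       λ {d} d∈ →
              let a , b , a∈ , b∈ , eq = sums d∈
                  U , U⊑ , σU = sumsA a∈
                  V , V⊑ , σV = sumsB b∈
              in U ⊞ V , ⊞-mono U S V T U⊑ V⊑ ,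
                 trans (σ-⊞ U V) (trans (cong₂ _⊕_ σU σV) (sym eq))
    where
      trivial : ∀ {a b} → a ∈ A → b ∈ B → a ⊕ b ≡ 0# → b ≡ 0#
      trivial a∈ b∈ eq with sumsA a∈ | sumsB b∈
      ... | U , U⊑ , refl | V , V⊑ , refl = trans (cong σ V≡𝟘) σ-𝟘
        where
          U⊞V≡𝟘 : U ⊞ V ≡ 𝟘
          U⊞V≡𝟘 = zeroSum⇒𝟘 (S ⊞ T) (U ⊞ V) free (⊞-mono U S V T U⊑ V⊑) (trans (σ-⊞ U V) eq)
          V≡𝟘 : V ≡ 𝟘
          V≡𝟘 = ∥∥≡0⇒≡𝟘 V (ℕ.m+n≡0⇒n≡0 ∥ U ∥ (trans (sym (∥⊞∥ U V)) (trans (cong ∥_∥ U⊞V≡𝟘) (∥𝟘∥ n))))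

  subsetSums-𝟘 : SubsetSums 𝟘 0
  subsetSums-𝟘 = 0# ∷ [] , [] ∷ [] , refl , here refl , λ { (here refl) → 𝟘 , 𝟘-⊑ 𝟘 , σ-𝟘 }

  subsetSums-single : ∀ {a} → ZeroSumFree (single a) → SubsetSums (single a) 1
  subsetSums-single {a} free = 0# ∷ a ∷ [] , (0≢a ∷ []) ∷ [] ∷ [] , refl , here refl , λ where
      (here refl)         → 𝟘 , 𝟘-⊑ (single a) , σ-𝟘
      (there (here refl)) → single a , (λ _ → ℕ.≤-refl) , σ-single a
    where
      0≢a : 0# ≢ a
      0≢a eq = element≢0 (single a) (single a) free (λ _ → ℕ.≤-refl) (subst (0 ℕ.<_) (sym (∥single∥ a)) (s≤s z≤n))
        (trans (σ-single a) (sym eq))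

  -- Any coincidence among 0, `a`, `b`, `a ⊕ b` other than `a ≡ b` makes the sum of a nonempty
  -- subsequence vanish. Two distinct elements thus yield three nonzero sums, one more than their
  -- number; this gain bounds the number of pairs.
  subsetSums-pair : ∀ {a b} → a ≢ b → ZeroSumFree (single a ⊞ single b) → SubsetSums (single a ⊞ single b) 3
  subsetSums-pair {a} {b} a≢b free = 0# ∷ a ∷ b ∷ a ⊕ b ∷ [] ,
      (0≢a ∷ 0≢b ∷ 0≢a⊕b ∷ []) ∷ (a≢b ∷ a≢a⊕b ∷ []) ∷ (b≢a⊕b ∷ []) ∷ [] ∷ [] , refl , here refl , λ where
        (here refl)                         → 𝟘 , 𝟘-⊑ (single a ⊞ single b) , σ-𝟘
        (there (here refl))                 → single a , ⊑-⊞ˡ (single a) (single b) , σ-single a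
        (there (there (here refl)))         → single b , ⊑-⊞ʳ (single a) (single b) , σ-single b
        (there (there (there (here refl)))) → single a ⊞ single b , (λ _ → ℕ.≤-refl) , σab
    where
      0<single : ∀ (x : Fin n) → 0 ℕ.< ∥ single x ∥
      0<single x = subst (0 ℕ.<_) (sym (∥single∥ x)) (s≤s z≤n)

      σab : σ (single a ⊞ single b) ≡ a ⊕ b
      σab = trans (σ-⊞ (single a) (single b)) (cong₂ _⊕_ (σ-single a) (σ-single b))

      0≢a : 0# ≢ a
      0≢a eq = element≢0 (single a ⊞ single b) (single a) free
        (⊑-⊞ˡ (single a) (single b)) (0<single a) (trans (σ-single a) (sym eq))

      0≢b : 0# ≢ b
      0≢b eq = element≢0 (single a ⊞ single b) (single b) free
        (⊑-⊞ʳ (single a) (single b)) (0<single b) (trans (σ-single b) (sym eq))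

      0≢a⊕b : 0# ≢ a ⊕ b
      0≢a⊕b eq = element≢0 (single a ⊞ single b) (single a ⊞ single b) free (λ _ → ℕ.≤-refl)
        (subst (0 ℕ.<_) (sym (∥⊞∥ (single a) (single b))) (ℕ.<-≤-trans (0<single a) (ℕ.m≤m+n _ _)))
        (trans σab (sym eq))

      a≢a⊕b : a ≢ a ⊕ b
      a≢a⊕b eq = 0≢b (sym (GP.∙-cancelˡ a b 0# (trans (sym eq) (sym (G.identityʳ a)))))

      b≢a⊕b : b ≢ a ⊕ b
      b≢a⊕b eq = 0≢a (sym (GP.∙-cancelʳ b a 0# (trans (sym eq) (sym (⊕-identityˡ b)))))

  subsetSums-replicate : ∀ c {g} → ZeroSumFree (bag (replicate c g)) → SubsetSums (bag (replicate c g)) c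
  subsetSums-replicate zero    free = subsetSums-𝟘
  subsetSums-replicate (suc c) {g} free = subsetSums-⊞ (single g) (bag (replicate c g)) free
    (subsetSums-single (zeroSumFree-⊞ˡ (single g) (bag (replicate c g)) free))
    (subsetSums-replicate c (zeroSumFree-⊞ʳ (single g) (bag (replicate c g)) free))

  -- Structure of long zero-sum free sequences

  -- The index counts the pairs. Only the two members of a pair have to differ; elements may recur
  -- in other pairs.
  data Paired : ℕ → List (Fin n) → Set where
    []   : Paired 0 []
    pair : ∀ {a b t xs} → a ≢ b → Paired t xs → Paired (suc t) (a ∷ b ∷ xs)

  length-paired : ∀ {t xs} → Paired t xs → length xs ≡ 2 ℕ.* t
  length-paired []                 = refl
  length-paired (pair {t = t} _ P) =
    trans (cong (λ l → suc (suc l)) (length-paired P)) (sym (ℕ.*-suc 2 t))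

  subsetSums-paired : ∀ {t xs} → Paired t xs → ZeroSumFree (bag xs) → SubsetSums (bag xs) (3 ℕ.* t)
  subsetSums-paired []                                        free = subsetSums-𝟘
  subsetSums-paired (pair {a} {b} {t} {xs} a≢b P) free =
    subst₂ SubsetSums eq (sym (ℕ.*-suc 3 t))
      (subsetSums-⊞ (single a ⊞ single b) (bag xs) free′
        (subsetSums-pair a≢b (zeroSumFree-⊞ˡ (single a ⊞ single b) (bag xs) free′))
        (subsetSums-paired P (zeroSumFree-⊞ʳ (single a ⊞ single b) (bag xs) free′)))
    where
      eq = ⊞-assoc (single a) (single b) (bag xs)
      free′ = subst ZeroSumFree (sym eq) free

  -- The Boyer–Moore majority vote.
  decompose : ∀ xs → ∃₂ λ g c → ∃₂ λ t ps → Paired t ps × bag xs ≡ bag (replicate c g) ⊞ bag ps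
  decompose []       = 0# , 0 , 0 , [] , [] , sym (⊞-identityˡ 𝟘)
  decompose (x ∷ xs) with decompose xs
  ... | g , c , t , ps , P , eq with x Fin.≟ g
  ...   | yes refl = g , suc c , t , ps , P , trans (cong (single x ⊞_) eq) (sym (⊞-assoc _ _ _))
  ...   | no x≢g with c
  ...     | zero   = x , 1 , t , ps , P , trans (cong (single x ⊞_) eq) (sym (⊞-assoc _ _ _))
  ...     | suc c′ = g , c′ , suc t , x ∷ g ∷ ps , pair x≢g P , (begin
    single x ⊞ bag xs                              ≡⟨ cong (single x ⊞_) eq ⟩
    single x ⊞ (single g ⊞ R ⊞ bag ps)
      ≡⟨ cong (λ T → single x ⊞ (T ⊞ bag ps)) (⊞-comm (single g) R) ⟩
    single x ⊞ (R ⊞ single g ⊞ bag ps)             ≡⟨ cong (single x ⊞_) (⊞-assoc R (single g) (bag ps)) ⟩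
    single x ⊞ (R ⊞ (single g ⊞ bag ps))           ≡⟨ ⊞-swap (single x) R (single g ⊞ bag ps) ⟩
    R ⊞ (single x ⊞ (single g ⊞ bag ps))           ∎)
    where
      open ≡-Reasoning
      R = bag (replicate c′ g)

  replicate-+ : ∀ c d (g : Fin n) → bag (replicate (c ℕ.+ d) g) ≡ bag (replicate c g) ⊞ bag (replicate d g)
  replicate-+ zero    d g = sym (⊞-identityˡ _)
  replicate-+ (suc c) d g = trans (cong (single g ⊞_) (replicate-+ c d g)) (sym (⊞-assoc _ _ _))

  -- The vote leaves `c₀ = c + 2 * j` copies of `g`, where `j = k ∸ t`. The surplus `2 * j` copies
  -- are put into the list with the pairs, so that its length is `2 * k` whatever `t` is; a fixed
  -- length lets words encode it.
  almostConstant : ∀ k c S → n ≡ 3 ℕ.* k ℕ.+ suc c → ZeroSumFree S → ∥ S ∥ ≡ c ℕ.+ 2 ℕ.* k →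
    ∃₂ λ g xs → length xs ≡ 2 ℕ.* k × S ≡ bag (replicate c g) ⊞ bag xs
  almostConstant k c S n≡ free ∥S∥≡ with bag-surjective S
  ... | ys , refl with decompose ys
  ...   | g , c₀ , t , ps , P , eq = g , replicate (2 ℕ.* j) g ++ ps ,
      (begin
        length (replicate (2 ℕ.* j) g ++ ps)          ≡⟨ List.length-++ (replicate (2 ℕ.* j) g) ⟩
        length (replicate (2 ℕ.* j) g) ℕ.+ length ps
          ≡⟨ cong₂ ℕ._+_ (List.length-replicate (2 ℕ.* j)) (length-paired P) ⟩
        2 ℕ.* j ℕ.+ 2 ℕ.* t                           ≡⟨ ℕ.*-distribˡ-+ 2 j t ⟨
        2 ℕ.* (j ℕ.+ t)                               ≡⟨ cong (2 ℕ.*_) j+t≡k ⟩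
        2 ℕ.* k                                       ∎) ,
      (begin
        bag ys                                                          ≡⟨ eq ⟩
        bag (replicate c₀ g) ⊞ bag ps
          ≡⟨ cong (λ m → bag (replicate m g) ⊞ bag ps) c₀≡ ⟩
        bag (replicate (c ℕ.+ 2 ℕ.* j) g) ⊞ bag ps
          ≡⟨ cong (_⊞ bag ps) (replicate-+ c (2 ℕ.* j) g) ⟩
        bag (replicate c g) ⊞ bag (replicate (2 ℕ.* j) g) ⊞ bag ps      ≡⟨ ⊞-assoc _ _ _ ⟩
        bag (replicate c g) ⊞ (bag (replicate (2 ℕ.* j) g) ⊞ bag ps)
          ≡⟨ cong (bag (replicate c g) ⊞_) (bag-++ (replicate (2 ℕ.* j) g) ps) ⟨
        bag (replicate c g) ⊞ bag (replicate (2 ℕ.* j) g ++ ps)         ∎)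
    where
      open ≡-Reasoning
      open +-*-Solver using (solve; _:=_; _:+_; _:*_; con)
      free′ : ZeroSumFree (bag (replicate c₀ g) ⊞ bag ps)
      free′ = subst ZeroSumFree eq free

      size : c₀ ℕ.+ 2 ℕ.* t ≡ c ℕ.+ 2 ℕ.* k
      size = trans (sym (trans (cong ∥_∥ eq) (trans (∥⊞∥ (bag (replicate c₀ g)) (bag ps))
        (cong₂ ℕ._+_ (trans (∥bag∥ (replicate c₀ g)) (List.length-replicate c₀))
                     (trans (∥bag∥ ps) (length-paired P)))))) ∥S∥≡

      -- The copies of `g` account for `c₀` sums and the pairs for `3 * t`. Together with the empty
      -- sum these are distinct elements of a group of order `n`.
      few : suc (c₀ ℕ.+ 3 ℕ.* t) ℕ.≤ n
      few with subsetSums-⊞ (bag (replicate c₀ g)) (bag ps) free′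
        (subsetSums-replicate c₀ (zeroSumFree-⊞ˡ (bag (replicate c₀ g)) (bag ps) free′))
        (subsetSums-paired P (zeroSumFree-⊞ʳ (bag (replicate c₀ g)) (bag ps) free′))
      ... | D , uD , ∣D∣ , _ = subst (ℕ._≤ n) ∣D∣ (length-unique uD)

      -- Sums exceed elements by one per pair. There are `c + 2 * k` elements and room for
      -- `c + 3 * k` sums besides 0, so the excess is at most `k`.
      t≤k : t ℕ.≤ k
      t≤k = ℕ.+-cancelˡ-≤ (suc (c ℕ.+ 2 ℕ.* k)) t k (subst₂ ℕ._≤_
        (trans (solve 2 (λ c t → con 1 :+ (c :+ con 3 :* t) := con 1 :+ (c :+ con 2 :* t) :+ t) refl c₀ t)
          (cong (λ m → suc (m ℕ.+ t)) size))
        (trans n≡ (solve 2 (λ c k → con 3 :* k :+ (con 1 :+ c) := con 1 :+ (c :+ con 2 :* k) :+ k) refl c k))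
        few)

      j = k ∸ t
      j+t≡k : j ℕ.+ t ≡ k
      j+t≡k = ℕ.m∸n+n≡m t≤k

      c₀≡ : c₀ ≡ c ℕ.+ 2 ℕ.* j
      c₀≡ = ℕ.+-cancelʳ-≡ (2 ℕ.* t) c₀ _ (trans size (trans (cong (λ m → c ℕ.+ 2 ℕ.* m) (sym j+t≡k))
        (solve 3 (λ c j t → c :+ con 2 :* (j :+ t) := c :+ con 2 :* j :+ con 2 :* t) refl c j t)))

  -- Multiples of a frequent element, and generators

  multiple≢0 : ∀ c {d g} → ZeroSumFree (bag (replicate c g)) → d ℕ.≤ c → 0 ℕ.< d → d · g ≢ 0#
  multiple≢0 c {d} {g} free d≤c 0<d eq = element≢0 (bag (replicate c g)) (bag (replicate d g)) free
    (subst (bag (replicate d g) ⊑_)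
      (trans (sym (replicate-+ d (c ∸ d) g)) (cong (λ m → bag (replicate m g)) (ℕ.m+[n∸m]≡n d≤c)))
      (⊑-⊞ˡ (bag (replicate d g)) (bag (replicate (c ∸ d) g))))
    (subst (0 ℕ.<_) (sym (trans (∥bag∥ (replicate d g)) (List.length-replicate d))) 0<d)
    (trans (σ-replicate d g) eq)

  -- The multiples 0·g, …, c·g are distinct and make up more than half of the group, so every
  -- a is a sum of two of them.
  free⇒generator : ∀ c {g} → ZeroSumFree (bag (replicate c g)) → n ℕ.≤ c ℕ.+ c → IsGenerator g
  free⇒generator c {g} free n≤2c a with Any.any? (λ h → ∈?-dec h H′) H
    where
      H  = List.applyUpTo (_· g) (suc c)
      H′ = map (λ h → a ⊕ ⊖ h) H
  ... | yes meet with find meet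
  ...   | h , h∈ , h∈′ with ∈-applyUpTo⁻ (_· g) h∈ | ∈-map⁻ (λ h → a ⊕ ⊖ h) h∈′
  ...     | i , _ , refl | h′ , h′∈ , eq with ∈-applyUpTo⁻ (_· g) h′∈
  ...       | j , _ , refl = i ℕ.+ j , (begin
    (i ℕ.+ j) · g                     ≡⟨ Mult.×-homo-+ g i j ⟩
    i · g ⊕ j · g                     ≡⟨ cong (_⊕ j · g) eq ⟩
    (a ⊕ ⊖ (j · g)) ⊕ j · g           ≡⟨ ⊕-assoc a _ _ ⟩
    a ⊕ (⊖ (j · g) ⊕ j · g)           ≡⟨ cong (a ⊕_) (⊖-inverseˡ (j · g)) ⟩
    a ⊕ 0#                            ≡⟨ G.identityʳ a ⟩
    a                                 ∎)
    where open ≡-Reasoning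
  free⇒generator c {g} free n≤2c a | no disjoint = contradiction too-many (ℕ.<⇒≱ (s≤s n≤2c))
    where
      H  = List.applyUpTo (_· g) (suc c)
      H′ = map (λ h → a ⊕ ⊖ h) H

      distinct : ∀ {i j} → i ℕ.< j → j ℕ.< suc c → i · g ≢ j · g
      distinct {i} {j} i<j (s≤s j≤c) eq = multiple≢0 c free (ℕ.≤-trans (ℕ.m∸n≤m j i) j≤c) (ℕ.m<n⇒0<n∸m i<j)
        (GP.∙-cancelˡ (i · g) _ _ (begin
          i · g ⊕ (j ∸ i) · g    ≡⟨ Mult.×-homo-+ g i (j ∸ i) ⟨
          (i ℕ.+ (j ∸ i)) · g    ≡⟨ cong (_· g) (ℕ.m+[n∸m]≡n (ℕ.<⇒≤ i<j)) ⟩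
          j · g                  ≡⟨ eq ⟨
          i · g                  ≡⟨ G.identityʳ (i · g) ⟨
          i · g ⊕ 0#             ∎))
        where open ≡-Reasoning

      uH : Unique H
      uH = Unique.applyUpTo⁺₁ (_· g) (suc c) distinct

      uH′ : Unique H′
      uH′ = Unique.map⁺ (λ {x} {y} eq → GP.⁻¹-injective (GP.∙-cancelˡ a (⊖ x) (⊖ y) eq)) uH

      too-many : suc (c ℕ.+ c) ℕ.≤ n
      too-many = ℕ.≤-trans (ℕ.≤-trans (ℕ.n≤1+n _) (ℕ.≤-reflexive (sym (begin
        length (H ++ H′)            ≡⟨ List.length-++ H ⟩
        length H ℕ.+ length H′      ≡⟨ cong (length H ℕ.+_) (List.length-map _ H) ⟩
        length H ℕ.+ length H       ≡⟨ cong (λ l → l ℕ.+ l) (List.length-applyUpTo (_· g) (suc c)) ⟩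
        suc c ℕ.+ suc c             ≡⟨ cong suc (ℕ.+-suc c c) ⟩
        suc (suc (c ℕ.+ c))         ∎))))
        (length-unique (Unique.++⁺ uH uH′ λ (x∈ , x∈′) → disjoint (lose x∈ x∈′)))
        where open ≡-Reasoning

  -- A zero-sum subsequence would consist of `j` copies of `g` with `0 < j < n`. Since some multiple
  -- of `g` is 1, `j · g = 0` yields `j · 1 = 0`, so that `n` divides `j`.
  generator⇒free : ∀ c {g} → IsGenerator g → c ℕ.< n → ZeroSumFree (bag (replicate c g))
  generator⇒free c {g} gen c<n (T , T⊑ , 0<T , zs) = ℕ.<⇒≢ 0<j (sym j≡0)
    where
      open ≡-Reasoning
      j = lookup T g

      T≡ : T ≡ bag (replicate j g)
      T≡ = lookup-ext λ a → case a Fin.≟ g of λ where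
        (yes refl) → sym (lookup-replicate j g)
        (no a≢g)   → trans
          (ℕ.n≤0⇒n≡0 (subst (lookup T a ℕ.≤_) (lookup-replicate′ c a≢g) (T⊑ a)))
          (sym (lookup-replicate′ j a≢g))

      0<j : 0 ℕ.< j
      0<j = subst (0 ℕ.<_) (trans (cong ∥_∥ T≡) (trans (∥bag∥ (replicate j g)) (List.length-replicate j))) 0<T

      j<n : j ℕ.< n
      j<n = ℕ.≤-<-trans (subst (j ℕ.≤_) (lookup-replicate c g) (T⊑ g)) c<n

      ·-0 : ∀ m → m · 0# ≡ 0#
      ·-0 zero    = refl
      ·-0 (suc m) = trans (⊕-identityˡ _) (·-0 m)

      m = proj₁ (gen (1 mod n))

      j·1≡0 : j · (1 mod n) ≡ 0#
      j·1≡0 = begin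
        j · (1 mod n)     ≡⟨ cong (j ·_) (proj₂ (gen (1 mod n))) ⟨
        j · (m · g)       ≡⟨ Mult.×-assocˡ g j m ⟩
        (j ℕ.* m) · g     ≡⟨ cong (_· g) (ℕ.*-comm j m) ⟩
        (m ℕ.* j) · g     ≡⟨ Mult.×-assocˡ g m j ⟨
        m · (j · g)       ≡⟨ cong (m ·_) (trans (sym (σ-replicate j g)) (trans (cong σ (sym T≡)) zs)) ⟩
        m · 0#            ≡⟨ ·-0 m ⟩
        0#                ∎

      j≡0 : j ≡ 0
      j≡0 = begin
        j                                 ≡⟨ m<n⇒m%n≡m j<n ⟨
        j % n                             ≡⟨ cong (_% n) (ℕ.*-identityʳ j) ⟨
        (j ℕ.* 1) % n
          -- The trivial group, where `1 % n` is not 1, is excluded by `0 < j < n`.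
          ≡⟨ cong (λ d → (j ℕ.* d) % n) (trans (toℕ-mod 1 n) (m<n⇒m%n≡m (ℕ.≤-<-trans 0<j j<n))) ⟨
        (j ℕ.* toℕ (1 mod n)) % n         ≡⟨ toℕ-· j (1 mod n) ⟨
        toℕ (j · (1 mod n))               ≡⟨ cong toℕ j·1≡0 ⟩
        toℕ 0#                            ≡⟨ toℕ-mod 0 n ⟩
        0 % n                             ≡⟨ m*n%n≡0 0 n ⟩
        0                                 ∎

  single-⊑ : ∀ {a : Fin n} {xs} → a ∈ xs → single a ⊑ bag xs
  single-⊑ {a} {_ ∷ xs} (here refl) = ⊑-⊞ˡ (single a) (bag xs)
  single-⊑ {a} {x ∷ xs} (there a∈)  =
    ⊑-trans (single a) (bag xs) (single x ⊞ bag xs) (single-⊑ a∈) (⊑-⊞ʳ (single x) (bag xs))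

  smallCoefficient : ∀ k c {g} xs {a} → n ≡ 3 ℕ.* k ℕ.+ suc c → IsGenerator g →
    ZeroSumFree (bag (replicate c g) ⊞ bag xs) → a ∈ xs → ∃ λ x → x ℕ.< suc (3 ℕ.* k) × x · g ≡ a
  smallCoefficient k c {g} xs {a} n≡ gen free a∈ = x , s≤s x≤3k , x·g≡a
    where
      open ≡-Reasoning
      -- Reducing modulo `n` keeps the multiple and makes `n ∸ x` a genuine difference.
      x = proj₁ (gen a) % n
      x·g≡a : x · g ≡ a
      x·g≡a = trans (%-· (proj₁ (gen a)) g) (proj₂ (gen a))

      n∸x+x≡n : n ∸ x ℕ.+ x ≡ n
      n∸x+x≡n = ℕ.m∸n+n≡m (ℕ.<⇒≤ (m%n<n (proj₁ (gen a)) n))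

      T = bag (replicate (n ∸ x) g) ⊞ single a

      σT≡0 : σ T ≡ 0#
      σT≡0 = begin
        σ T                            ≡⟨ σ-⊞ (bag (replicate (n ∸ x) g)) (single a) ⟩
        σ (bag (replicate (n ∸ x) g)) ⊕ σ (single a)
                                       ≡⟨ cong₂ _⊕_ (σ-replicate (n ∸ x) g) (trans (σ-single a) (sym x·g≡a)) ⟩
        (n ∸ x) · g ⊕ x · g            ≡⟨ Mult.×-homo-+ g (n ∸ x) x ⟨
        (n ∸ x ℕ.+ x) · g              ≡⟨ cong (_· g) n∸x+x≡n ⟩
        n · g                          ≡⟨ n· g ⟩
        0#                             ∎

      -- Otherwise the `n ∸ x` copies of `g` needed for `T` are among the `c` available ones, and
      -- `T` is a zero-sum subsequence.
      c<n∸x : c ℕ.< n ∸ x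
      c<n∸x = ℕ.≰⇒> λ n∸x≤c → element≢0 (bag (replicate c g) ⊞ bag xs) T free
        (⊞-mono (bag (replicate (n ∸ x) g)) (bag (replicate c g)) (single a) (bag xs)
          (subst (bag (replicate (n ∸ x) g) ⊑_)
            (trans (sym (replicate-+ (n ∸ x) (c ∸ (n ∸ x)) g))
                   (cong (λ m → bag (replicate m g)) (ℕ.m+[n∸m]≡n n∸x≤c)))
            (⊑-⊞ˡ (bag (replicate (n ∸ x) g)) _))
          (single-⊑ a∈))
        (subst (0 ℕ.<_) (sym (∥⊞∥ (bag (replicate (n ∸ x) g)) (single a)))
          (ℕ.<-≤-trans (subst (0 ℕ.<_) (sym (∥single∥ a)) (s≤s z≤n)) (ℕ.m≤n+m _ _)))
        σT≡0

      x≤3k : x ℕ.≤ 3 ℕ.* k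
      x≤3k = ℕ.+-cancelʳ-≤ (suc c) x (3 ℕ.* k) (subst₂ ℕ._≤_ (ℕ.+-comm (suc c) x) (trans n∸x+x≡n n≡)
        (ℕ.+-monoˡ-≤ x c<n∸x))

-- Size of the support

supp : ∀ {n} → Sequence n → ℕ
supp []          = 0
supp (zero ∷ S)  = supp S
supp (suc _ ∷ S) = suc (supp S)

supp-single-⊞ : ∀ {n} (a : Fin n) S → supp (single a ⊞ S) ℕ.≤ suc (supp S)
supp-single-⊞ zero (zero ∷ S)  = ℕ.≤-reflexive (cong (suc ∘ supp) (⊞-identityˡ S))
supp-single-⊞ zero (suc _ ∷ S) = s≤s (ℕ.≤-trans (ℕ.≤-reflexive (cong supp (⊞-identityˡ S))) (ℕ.n≤1+n _))
supp-single-⊞ (suc a) (zero ∷ S)  = supp-single-⊞ a S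
supp-single-⊞ (suc a) (suc _ ∷ S) = s≤s (supp-single-⊞ a S)

supp-bag-⊞ : ∀ {n} xs (S : Sequence n) → supp (bag xs ⊞ S) ℕ.≤ length xs ℕ.+ supp S
supp-bag-⊞ []       S = ℕ.≤-reflexive (cong supp (⊞-identityˡ S))
supp-bag-⊞ (x ∷ xs) S = ℕ.≤-trans (ℕ.≤-reflexive (cong supp (⊞-assoc (single x) (bag xs) S)))
  (ℕ.≤-trans (supp-single-⊞ x _) (s≤s (supp-bag-⊞ xs S)))

lookup>0⇒supp>0 : ∀ {n} (S : Sequence n) a → 0 ℕ.< lookup S a → 0 ℕ.< supp S
lookup>0⇒supp>0 (suc _ ∷ S) a       _   = s≤s z≤n
lookup>0⇒supp>0 (zero ∷ S)  (suc a) 0<S = lookup>0⇒supp>0 S a 0<S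

supp≡0⇒lookup≡0 : ∀ {n} (S : Sequence n) a → supp S ≡ 0 → lookup S a ≡ 0
supp≡0⇒lookup≡0 S a eq with lookup S a in eq′
... | zero  = refl
... | suc m = contradiction
  (lookup>0⇒supp>0 S a (subst (0 ℕ.<_) (sym eq′) (s≤s z≤n)))
  (subst (λ s → ¬ 0 ℕ.< s) (sym eq) λ ())

supp≤1⇒lookup≡0 : ∀ {n} (S : Sequence n) {a b} → supp S ℕ.≤ 1 → 0 ℕ.< lookup S a → b ≢ a → lookup S b ≡ 0
supp≤1⇒lookup≡0 (s ∷ S)     {zero}  {zero}  _       _   b≢a = contradiction refl b≢a
supp≤1⇒lookup≡0 (suc s ∷ S) {zero}  {suc b} (s≤s h) _   _   = supp≡0⇒lookup≡0 S b (ℕ.n≤0⇒n≡0 h)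
supp≤1⇒lookup≡0 (zero ∷ S)  {suc a} {zero}  _       _   _   = refl
supp≤1⇒lookup≡0 (suc s ∷ S) {suc a} {_}     (s≤s h) 0<S _   = contradiction (lookup>0⇒supp>0 S a 0<S) (ℕ.≤⇒≯ h)
supp≤1⇒lookup≡0 (zero ∷ S)  {suc a} {suc b} h       0<S b≢a = supp≤1⇒lookup≡0 S h 0<S (b≢a ∘ cong suc)

lookup≡0⇒supp≡0 : ∀ {n} (S : Sequence n) → (∀ a → lookup S a ≡ 0) → supp S ≡ 0
lookup≡0⇒supp≡0 []          _ = refl
lookup≡0⇒supp≡0 (zero ∷ S)  h = lookup≡0⇒supp≡0 S (h ∘ suc)
lookup≡0⇒supp≡0 (suc _ ∷ S) h = contradiction (h zero) λ ()

lookup≡0⇒supp≤1 : ∀ {n} g (S : Sequence n) → (∀ a → a ≢ g → lookup S a ≡ 0) → supp S ℕ.≤ 1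
lookup≡0⇒supp≤1 zero    (zero ∷ S)  h = ℕ.≤-trans (ℕ.≤-reflexive (lookup≡0⇒supp≡0 S λ a → h (suc a) λ ())) z≤n
lookup≡0⇒supp≤1 zero    (suc _ ∷ S) h = s≤s (ℕ.≤-reflexive (lookup≡0⇒supp≡0 S λ a → h (suc a) λ ()))
lookup≡0⇒supp≤1 (suc g) (zero ∷ S)  h = lookup≡0⇒supp≤1 g S λ a a≢g → h (suc a) (a≢g ∘ Fin.suc-injective)
lookup≡0⇒supp≤1 (suc g) (suc _ ∷ S) h = contradiction (h zero λ ()) λ ()

supp-replicate≤1 : ∀ {n} c (g : Fin n) → supp (bag (replicate c g)) ℕ.≤ 1
supp-replicate≤1 c g = lookup≡0⇒supp≤1 g (bag (replicate c g)) λ a → lookup-replicate′ c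

-- Counting long zero-sum free sequences

length-cartesianProductWith : ∀ {A B C : Set} (f : A → B → C) xs ys →
  length (cartesianProductWith f xs ys) ≡ length xs ℕ.* length ys
length-cartesianProductWith f []       ys = refl
length-cartesianProductWith f (x ∷ xs) ys = trans (List.length-++ (map (f x) ys))
  (cong₂ ℕ._+_ (List.length-map (f x) ys) (length-cartesianProductWith f xs ys))

words : ℕ → ℕ → List (List ℕ)
words m zero    = [] ∷ []
words m (suc l) = cartesianProductWith _∷_ (upTo m) (words m l)

length-words : ∀ m l → length (words m l) ≡ m ℕ.^ l
length-words m zero    = refl
length-words m (suc l) = trans (length-cartesianProductWith _∷_ (upTo m) (words m l))
  (cong₂ ℕ._*_ (List.length-upTo m) (length-words m l))

∈-words : ∀ {m xs} → All (ℕ._< m) xs → xs ∈ words m (length xs)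
∈-words []         = here refl
∈-words (x< ∷ xs<) = ∈-cartesianProductWith⁺ _∷_ (∈-upTo⁺ x<) (∈-words xs<)

module _ {n : ℕ} .{{_ : NonZero n}} where

  generators : List (Fin n)
  generators = filter isGenerator? (allFin n)

  freeSequences : ℕ → List (Sequence n)
  freeSequences ℓ = filter zeroSumFree? (sequences n ℓ)

  freeSequences-unique : ∀ ℓ → Unique (freeSequences ℓ)
  freeSequences-unique ℓ = Unique.filter⁺ zeroSumFree? (sequences-unique n ℓ)

  ∈-freeSequences⁻ : ∀ {ℓ S} → S ∈ freeSequences ℓ → ∥ S ∥ ≡ ℓ × ZeroSumFree S
  ∈-freeSequences⁻ {ℓ} S∈ = let S∈′ , free = ∈-filter⁻ zeroSumFree? {xs = sequences n ℓ} S∈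
                             in sequences-sound n ℓ S∈′ , free

  ∈-freeSequences⁺ : ∀ {ℓ S} → ∥ S ∥ ≡ ℓ → ZeroSumFree S → S ∈ freeSequences ℓ
  ∈-freeSequences⁺ {S = S} refl free = ∈-filter⁺ zeroSumFree? (sequences-complete S) free

  -- The element 1 generates. Positivity is what permits dividing by `φ n` in the relative error.
  0<φ : 0 ℕ.< φ n
  0<φ = List.filter-some isGenerator? (lose (∈-allFin (1 mod n)) one)
    where
      one : IsGenerator (1 mod n)
      one a = toℕ a , Fin.toℕ-injective (begin
        toℕ (toℕ a · (1 mod n))               ≡⟨ toℕ-· (toℕ a) (1 mod n) ⟩
        (toℕ a ℕ.* toℕ (1 mod n)) % n         ≡⟨ cong₂ (λ b c → (b ℕ.* c) % n) (sym (toℕ-% a)) (toℕ-mod 1 n) ⟩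
        (toℕ a % n ℕ.* (1 % n)) % n           ≡⟨ %-distribˡ-* (toℕ a) 1 n ⟨
        (toℕ a ℕ.* 1) % n                     ≡⟨ cong (_% n) (ℕ.*-identityʳ (toℕ a)) ⟩
        toℕ a % n                             ≡⟨ toℕ-% a ⟩
        toℕ a                                 ∎)
        where open ≡-Reasoning

  -- Here `c` is `n - 1 - 3k` and `ℓ` is `n - 1 - k`, specified by equations that avoid truncated
  -- subtraction. Given the first, `n ≤ c + c` says that `n` is at least `6k + 2`.
  module Long (k c ℓ : ℕ) (n≡ : n ≡ 3 ℕ.* k ℕ.+ suc c) (n≤2c : n ℕ.≤ c ℕ.+ c) (ℓ≡ : ℓ ≡ c ℕ.+ 2 ℕ.* k) where

    0<c : 0 ℕ.< c
    0<c = ℕ.n≢0⇒n>0 λ { refl → contradiction (subst (ℕ._≤ 0) n≡ n≤2c) λ h →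
      contradiction (ℕ.≤-trans (ℕ.m≤n+m 1 (3 ℕ.* k)) h) λ () }

    ℓ<n : ℓ ℕ.< n
    ℓ<n = subst₂ ℕ._<_ (sym ℓ≡) (sym (trans n≡ (ℕ.+-comm (3 ℕ.* k) (suc c))))
      (s≤s (ℕ.+-monoʳ-≤ c (ℕ.*-monoˡ-≤ k {2} {3} (s≤s (s≤s z≤n)))))

    -- The rest is recorded by coefficients relative to `g` instead of group elements, because their
    -- range `0, …, 3k` does not grow with `n`.
    decode : Fin n → List ℕ → Sequence n
    decode g xs = bag (replicate c g) ⊞ bag (map (_· g) xs)

    structure : ∀ {S} → S ∈ freeSequences ℓ →
      ∃₂ λ g xs → IsGenerator g × All (ℕ._< suc (3 ℕ.* k)) xs × length xs ≡ 2 ℕ.* k × S ≡ decode g xs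
    structure {S} S∈ with ∈-freeSequences⁻ S∈
    ... | ∥S∥ , free with almostConstant k c S n≡ free (trans ∥S∥ ℓ≡)
    ... | g , ys , ∣ys∣ , refl with encode ys id
      where
        gen : IsGenerator g
        gen = free⇒generator c (zeroSumFree-⊞ˡ (bag (replicate c g)) (bag ys) free) n≤2c

        encode : ∀ zs → (∀ {z} → z ∈ zs → z ∈ ys) →
          ∃ λ xs → IsGenerator g × All (ℕ._< suc (3 ℕ.* k)) xs × zs ≡ map (_· g) xs
        encode []       _  = [] , gen , [] , refl
        encode (z ∷ zs) ⊆ with smallCoefficient k c ys n≡ gen free (⊆ (here refl)) | encode zs (⊆ ∘ there)
        ... | x , x< , refl | xs , _ , xs< , refl = x ∷ xs , gen , x< ∷ xs< , refl
    ...   | xs , gen , xs< , refl = g , xs , gen , xs< , trans (sym (List.length-map (_· g) xs)) ∣ys∣ , refl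

    -- For an upper bound it suffices that `decode` reaches every zero-sum free sequence: there are
    -- `φ n` choices of generator and `(3k + 1) ^ (2k)` words.
    length-freeSequences : length (freeSequences ℓ) ℕ.≤ φ n ℕ.* suc (3 ℕ.* k) ℕ.^ (2 ℕ.* k)
    length-freeSequences = subst (length (freeSequences ℓ) ℕ.≤_)
      (trans (length-cartesianProductWith decode generators (words (suc (3 ℕ.* k)) (2 ℕ.* k)))
             (cong (φ n ℕ.*_) (length-words (suc (3 ℕ.* k)) (2 ℕ.* k))))
      (length-⊆ (freeSequences-unique ℓ) covered)
      where
        covered : ∀ {S} → S ∈ freeSequences ℓ →
          S ∈ cartesianProductWith decode generators (words (suc (3 ℕ.* k)) (2 ℕ.* k))
        covered S∈ with structure S∈
        ... | g , xs , gen , xs< , ∣xs∣ , refl = ∈-cartesianProductWith⁺ decode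
          (∈-filter⁺ isGenerator? (∈-allFin g) gen)
          (subst (λ l → xs ∈ words (suc (3 ℕ.* k)) l) ∣xs∣ (∈-words xs<))

    lookup-decode>0 : ∀ g xs → 0 ℕ.< lookup (decode g xs) g
    lookup-decode>0 g xs = ℕ.<-≤-trans 0<c (subst (ℕ._≤ lookup (decode g xs) g) (lookup-replicate c g)
      (⊑-⊞ˡ (bag (replicate c g)) (bag (map (_· g) xs)) g))

    supp>0 : ∀ {S} → S ∈ freeSequences ℓ → 0 ℕ.< supp S
    supp>0 S∈ with structure S∈
    ... | g , xs , _ , _ , _ , refl = lookup>0⇒supp>0 (decode g xs) g (lookup-decode>0 g xs)

    supp≤ : ∀ {S} → S ∈ freeSequences ℓ → supp S ℕ.≤ suc (2 ℕ.* k)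
    supp≤ S∈ with structure S∈
    ... | g , xs , _ , _ , ∣xs∣ , refl = begin
      supp (R ⊞ bag ys)                   ≡⟨ cong supp (⊞-comm R (bag ys)) ⟩
      supp (bag ys ⊞ R)                   ≤⟨ supp-bag-⊞ ys R ⟩
      length ys ℕ.+ supp R                ≤⟨ ℕ.+-monoʳ-≤ (length ys) (supp-replicate≤1 c g) ⟩
      length ys ℕ.+ 1                     ≡⟨ cong (ℕ._+ 1) (trans (List.length-map (_· g) xs) ∣xs∣) ⟩
      2 ℕ.* k ℕ.+ 1                       ≡⟨ ℕ.+-comm (2 ℕ.* k) 1 ⟩
      suc (2 ℕ.* k)                       ∎
      where
        open ℕ.≤-Reasoning
        R = bag (replicate c g)
        ys = map (_· g) xs

    oneElement? = λ (S : Sequence n) → supp S ℕ.≟ 1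

    -- These sequences are matched with the generators: the dominant element given by `structure` is
    -- a generator and fills the whole support, and conversely `ℓ < n` copies of a generator are
    -- zero-sum free.
    length-oneElement : length (filter oneElement? (freeSequences ℓ)) ≡ φ n
    length-oneElement = trans
      (ℕ.≤-antisym (length-⊆ (Unique.filter⁺ oneElement? (freeSequences-unique ℓ)) ⊆)
                   (length-⊆ (Unique.map⁺ constant-injective (Unique.filter⁺ isGenerator? (Unique.allFin⁺ n))) ⊇))
      (List.length-map constant generators)
      where
        constant : Fin n → Sequence n
        constant g = bag (replicate ℓ g)

        0<ℓ : 0 ℕ.< ℓ
        0<ℓ = subst (0 ℕ.<_) (sym ℓ≡) (ℕ.<-≤-trans 0<c (ℕ.m≤m+n c _))

        0<constant : ∀ g → 0 ℕ.< lookup (constant g) g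
        0<constant g = subst (0 ℕ.<_) (sym (lookup-replicate ℓ g)) 0<ℓ

        constant-injective : ∀ {g h} → constant g ≡ constant h → g ≡ h
        constant-injective {g} {h} eq with g Fin.≟ h
        ... | yes g≡h = g≡h
        ... | no  g≢h = contradiction
          (trans (cong (λ S → lookup S g) eq) (lookup-replicate′ ℓ g≢h)) (ℕ.>⇒≢ (0<constant g))

        ⊆ : ∀ {S} → S ∈ filter oneElement? (freeSequences ℓ) → S ∈ map constant generators
        ⊆ S∈ with ∈-filter⁻ oneElement? {xs = freeSequences ℓ} S∈
        ... | S∈′ , one with structure S∈′
        ...   | g , xs , gen , _ , _ , refl = subst (_∈ map constant generators) (sym S≡)
            (∈-map⁺ constant (∈-filter⁺ isGenerator? (∈-allFin g) gen))
          where
            S = decode g xs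
            S≡replicate : S ≡ bag (replicate (lookup S g) g)
            S≡replicate = lookup-ext λ a → case a Fin.≟ g of λ where
              (yes refl) → sym (lookup-replicate (lookup S g) g)
              (no a≢g)   → trans (supp≤1⇒lookup≡0 S (ℕ.≤-reflexive one) (lookup-decode>0 g xs) a≢g)
                                 (sym (lookup-replicate′ (lookup S g) a≢g))
            ∥S∥≡lookup : ∥ S ∥ ≡ lookup S g
            ∥S∥≡lookup = trans (cong ∥_∥ S≡replicate)
              (trans (∥bag∥ (replicate (lookup S g) g)) (List.length-replicate (lookup S g)))
            S≡ : S ≡ constant g
            S≡ = trans S≡replicate (cong (λ m → bag (replicate m g))
              (trans (sym ∥S∥≡lookup) (proj₁ (∈-freeSequences⁻ S∈′))))

        ⊇ : ∀ {S} → S ∈ map constant generators → S ∈ filter oneElement? (freeSequences ℓ)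
        ⊇ S∈ with ∈-map⁻ constant S∈
        ... | g , g∈ , refl = ∈-filter⁺ oneElement?
          (∈-freeSequences⁺ (trans (∥bag∥ (replicate ℓ g)) (List.length-replicate ℓ))
            (generator⇒free ℓ (proj₂ (∈-filter⁻ isGenerator? {xs = allFin n} g∈)) ℓ<n))
          (ℕ.≤-antisym (supp-replicate≤1 ℓ g) (lookup>0⇒supp>0 (constant g) g (0<constant g)))

-- Rational arithmetic and finite sums

open RawSemiringDefinitions (Semiring.rawSemiring (CommutativeRing.semiring ℚ.+-*-commutativeRing))
  using (_^_)
module ℝ^ = RawSemiringDefinitions (Semiring.rawSemiring (CommutativeRing.semiring ℝ-commutativeRing))

toℚ : ℕ → ℚ
toℚ m = ℤ.+ m ℚ./ 1

toℚ-homo-+ : ∀ a b → toℚ (a ℕ.+ b) ≡ toℚ a ℚ.+ toℚ b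
toℚ-homo-+ a b = ℚ.toℚᵘ-injective (begin
  ℚ.toℚᵘ (toℚ (a ℕ.+ b))                       ≈⟨ ℚ.toℚᵘ-fromℚᵘ (ℚᵘ.mkℚᵘ (ℤ.+ (a ℕ.+ b)) 0) ⟩
  ℚᵘ.mkℚᵘ (ℤ.+ (a ℕ.+ b)) 0
    ≈⟨ ℚᵘ.*≡* (cong (ℤ._* ℤ.1ℤ) (sym (cong₂ ℤ._+_ (ℤ.*-identityʳ (ℤ.+ a)) (ℤ.*-identityʳ (ℤ.+ b))))) ⟩
  ℚᵘ.mkℚᵘ (ℤ.+ a) 0 ℚᵘ.+ ℚᵘ.mkℚᵘ (ℤ.+ b) 0
    ≈⟨ ℚᵘ.+-cong (ℚ.toℚᵘ-fromℚᵘ (ℚᵘ.mkℚᵘ (ℤ.+ a) 0)) (ℚ.toℚᵘ-fromℚᵘ (ℚᵘ.mkℚᵘ (ℤ.+ b) 0)) ⟨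
  ℚ.toℚᵘ (toℚ a) ℚᵘ.+ ℚ.toℚᵘ (toℚ b)           ≈⟨ ℚ.toℚᵘ-homo-+ (toℚ a) (toℚ b) ⟨
  ℚ.toℚᵘ (toℚ a ℚ.+ toℚ b)                     ∎)
  where open import Relation.Binary.Reasoning.Setoid ℚᵘ.≃-setoid

toℚ-homo-* : ∀ a b → toℚ (a ℕ.* b) ≡ toℚ a ℚ.* toℚ b
toℚ-homo-* zero    b = sym (ℚ.*-zeroˡ (toℚ b))
toℚ-homo-* (suc a) b = begin
  toℚ (b ℕ.+ a ℕ.* b)               ≡⟨ toℚ-homo-+ b (a ℕ.* b) ⟩
  toℚ b ℚ.+ toℚ (a ℕ.* b)           ≡⟨ cong (toℚ b ℚ.+_) (toℚ-homo-* a b) ⟩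
  toℚ b ℚ.+ toℚ a ℚ.* toℚ b
    ≡⟨ solve 2 (λ x y → y :+ x :* y := (con 1ℚ :+ x) :* y) refl (toℚ a) (toℚ b) ⟩
  (1ℚ ℚ.+ toℚ a) ℚ.* toℚ b          ≡⟨ cong (ℚ._* toℚ b) (toℚ-homo-+ 1 a) ⟨
  toℚ (suc a) ℚ.* toℚ b             ∎
  where open ≡-Reasoning
        open ℚ-Solver

0≤toℚ : ∀ m → 0ℚ ℚ.≤ toℚ m
0≤toℚ zero    = ℚ.≤-refl
0≤toℚ (suc m) = subst (0ℚ ℚ.≤_) (sym (toℚ-homo-+ 1 m)) (ℚ.+-mono-≤ (ℚ.nonNegative⁻¹ 1ℚ) (0≤toℚ m))

toℚ-mono : ∀ {a b} → a ℕ.≤ b → toℚ a ℚ.≤ toℚ b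
toℚ-mono {a} {b} a≤b = subst₂ ℚ._≤_ (ℚ.+-identityʳ (toℚ a))
  (trans (sym (toℚ-homo-+ a (b ∸ a))) (cong toℚ (ℕ.m+[n∸m]≡n a≤b)))
  (ℚ.+-monoʳ-≤ (toℚ a) (0≤toℚ (b ∸ a)))

0<toℚ : ∀ {m} → 0 ℕ.< m → 0ℚ ℚ.< toℚ m
0<toℚ 0<m = ℚ.<-≤-trans (ℚ.positive⁻¹ 1ℚ) (toℚ-mono 0<m)

≤-scaleˡ : ∀ {x y} a → 0ℚ ℚ.≤ a → x ℚ.≤ y → a ℚ.* x ℚ.≤ a ℚ.* y
≤-scaleˡ a 0≤a = ℚ.*-monoˡ-≤-nonNeg a {{ℚ.nonNegative 0≤a}}

≤-scaleʳ : ∀ {x y} a → 0ℚ ℚ.≤ a → x ℚ.≤ y → x ℚ.* a ℚ.≤ y ℚ.* a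
≤-scaleʳ a 0≤a = ℚ.*-monoʳ-≤-nonNeg a {{ℚ.nonNegative 0≤a}}

module _ {A : Set} where

  sumOf : (A → ℚ) → List A → ℚ
  sumOf f = List.foldr (λ x s → f x ℚ.+ s) 0ℚ

  sumOf-cong : ∀ {f g : A → ℚ} xs → (∀ {x} → x ∈ xs → f x ≡ g x) → sumOf f xs ≡ sumOf g xs
  sumOf-cong []       _  = refl
  sumOf-cong (x ∷ xs) eq = cong₂ ℚ._+_ (eq (here refl)) (sumOf-cong xs (eq ∘ there))

  sumOf-++ : ∀ (f : A → ℚ) xs ys → sumOf f (xs ++ ys) ≡ sumOf f xs ℚ.+ sumOf f ys
  sumOf-++ f []       ys = sym (ℚ.+-identityˡ _)
  sumOf-++ f (x ∷ xs) ys = trans (cong (f x ℚ.+_) (sumOf-++ f xs ys)) (sym (ℚ.+-assoc (f x) _ _))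

  sumOf-+ : ∀ (f g : A → ℚ) xs → sumOf (λ x → f x ℚ.+ g x) xs ≡ sumOf f xs ℚ.+ sumOf g xs
  sumOf-+ f g []       = refl
  sumOf-+ f g (x ∷ xs) = trans (cong (f x ℚ.+ g x ℚ.+_) (sumOf-+ f g xs))
    (solve 4 (λ a b c d → (a :+ b) :+ (c :+ d) := (a :+ c) :+ (b :+ d)) refl
      (f x) (g x) (sumOf f xs) (sumOf g xs))
    where open ℚ-Solver

  sumOf-* : ∀ a (f : A → ℚ) xs → sumOf (λ x → a ℚ.* f x) xs ≡ a ℚ.* sumOf f xs
  sumOf-* a f []       = sym (ℚ.*-zeroʳ a)
  sumOf-* a f (x ∷ xs) = trans (cong (a ℚ.* f x ℚ.+_) (sumOf-* a f xs)) (sym (ℚ.*-distribˡ-+ a (f x) _))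

  sumOf-const : ∀ a xs → sumOf (λ (_ : A) → a) xs ≡ toℚ (length xs) ℚ.* a
  sumOf-const a []       = sym (ℚ.*-zeroˡ a)
  sumOf-const a (x ∷ xs) = trans (cong (a ℚ.+_) (sumOf-const a xs)) (trans
    (solve 2 (λ a l → a :+ l :* a := (con 1ℚ :+ l) :* a) refl a (toℚ (length xs)))
    (cong (ℚ._* a) (sym (toℚ-homo-+ 1 (length xs)))))
    where open ℚ-Solver

  sumOf-split : ∀ {P : A → Set} (P? : Decidable P) (f : A → ℚ) xs →
    sumOf f xs ≡ sumOf f (filter P? xs) ℚ.+ sumOf f (filter (¬? ∘ P?) xs)
  sumOf-split P? f []       = refl
  sumOf-split P? f (x ∷ xs) with P? x
  ... | yes _ = trans (cong (f x ℚ.+_) (sumOf-split P? f xs)) (sym (ℚ.+-assoc (f x) _ _))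
  ... | no  _ = trans (cong (f x ℚ.+_) (sumOf-split P? f xs))
    (solve 3 (λ a b c → a :+ (b :+ c) := b :+ (a :+ c)) refl
      (f x) (sumOf f (filter P? xs)) (sumOf f (filter (¬? ∘ P?) xs)))
    where open ℚ-Solver

  ∣sumOf∣≤ : ∀ {b} (f : A → ℚ) xs → (∀ {x} → x ∈ xs → ℚ.∣ f x ∣ ℚ.≤ b) →
    ℚ.∣ sumOf f xs ∣ ℚ.≤ toℚ (length xs) ℚ.* b
  ∣sumOf∣≤ {b} f xs ≤b = subst (ℚ.∣ sumOf f xs ∣ ℚ.≤_) (sumOf-const b xs) (go xs ≤b)
    where
      go : ∀ xs → (∀ {x} → x ∈ xs → ℚ.∣ f x ∣ ℚ.≤ b) → ℚ.∣ sumOf f xs ∣ ℚ.≤ sumOf (λ _ → b) xs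
      go []       _  = ℚ.≤-refl
      go (x ∷ xs) ≤b = ℚ.≤-trans (ℚ.∣p+q∣≤∣p∣+∣q∣ (f x) (sumOf f xs))
        (ℚ.+-mono-≤ (≤b (here refl)) (go xs (≤b ∘ there)))

sumOf-map : ∀ {A B : Set} (f : A → ℚ) (h : B → A) xs → sumOf f (map h xs) ≡ sumOf (f ∘ h) xs
sumOf-map f h []       = refl
sumOf-map f h (x ∷ xs) = cong (f (h x) ℚ.+_) (sumOf-map f h xs)

-- Expectation over random subsets

-- `weight` and `expect` are `ℙ` and `𝔼` at one rational term `q` of the sequence representing `p`.
-- The identities below are polynomial in `q`, so they hold at every index even when `q` lies
-- outside the interval from 0 to 1.
weight : ∀ {n} → ℚ → Subset n → ℚ
weight q []      = 1ℚ
weight q (x ∷ R) = (if x then q else 1ℚ ℚ.- q) ℚ.* weight q R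

expect : ∀ {n} → ℚ → (Subset n → ℚ) → ℚ
expect {n} q f = sumOf (λ R → weight q R ℚ.* f R) (subsets n)

seq-ℙ : ∀ p i {n} (R : Subset n) → seq (ℙ p R) i ≡ weight (seq p i) R
seq-ℙ p i []            = refl
seq-ℙ p i (true ∷ R)  = cong (seq p i ℚ.*_) (seq-ℙ p i R)
seq-ℙ p i (false ∷ R) = cong ((1ℚ ℚ.- seq p i) ℚ.*_) (seq-ℙ p i R)

seq-∑ : ∀ {A : Set} (f : A → ℝ) i xs → seq (∑ (map f xs)) i ≡ sumOf (λ x → seq (f x) i) xs
seq-∑ f i []       = refl
seq-∑ f i (x ∷ xs) = cong (seq (f x) i ℚ.+_) (seq-∑ f i xs)

seq-^ : ∀ x d i → seq (x ℝ^.^ d) i ≡ seq x i ^ d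
seq-^ x zero    i = refl
seq-^ x (suc d) i = cong (seq x i ℚ.*_) (seq-^ x d i)

seq-𝔼 : ∀ {n} p (X : Subset n → ℝ) i → seq (𝔼 p X) i ≡ expect (seq p i) (λ R → seq (X R) i)
seq-𝔼 {n} p X i = trans (seq-∑ (λ R → ℙ p R * X R) i (subsets n))
  (sumOf-cong (subsets n) λ {R} _ → cong (ℚ._* seq (X R) i) (seq-ℙ p i R))

module _ {n : ℕ} (q : ℚ) where

  expect-cong : ∀ {f g : Subset n → ℚ} → (∀ R → f R ≡ g R) → expect q f ≡ expect q g
  expect-cong eq = sumOf-cong (subsets n) λ {R} _ → cong (weight q R ℚ.*_) (eq R)

  expect-+ : ∀ (f g : Subset n → ℚ) → expect q (λ R → f R ℚ.+ g R) ≡ expect q f ℚ.+ expect q g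
  expect-+ f g = trans
    (sumOf-cong (subsets n) λ {R} _ → ℚ.*-distribˡ-+ (weight q R) (f R) (g R))
    (sumOf-+ (λ R → weight q R ℚ.* f R) (λ R → weight q R ℚ.* g R) (subsets n))

  expect-0 : expect q (λ (_ : Subset n) → 0ℚ) ≡ 0ℚ
  expect-0 = trans (sumOf-cong (subsets n) λ {R} _ → ℚ.*-zeroʳ (weight q R))
    (trans (sumOf-const 0ℚ (subsets n)) (ℚ.*-zeroʳ (toℚ (length (subsets n)))))

-- Conditioning on whether the first element is chosen.
expect-suc : ∀ {n} q (f : Subset (suc n) → ℚ) →
  expect q f ≡ q ℚ.* expect q (f ∘ (inside ∷_)) ℚ.+ (1ℚ ℚ.- q) ℚ.* expect q (f ∘ (outside ∷_))
expect-suc {n} q f = trans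
  (sumOf-++ (λ R → weight q R ℚ.* f R) (map (inside ∷_) (subsets n)) (map (outside ∷_) (subsets n)))
  (cong₂ ℚ._+_ (part inside) (part outside))
  where
    part : ∀ x → sumOf (λ R → weight q R ℚ.* f R) (map (x ∷_) (subsets n)) ≡
                 (if x then q else 1ℚ ℚ.- q) ℚ.* expect q (f ∘ (x ∷_))
    part x = trans (sumOf-map (λ R → weight q R ℚ.* f R) (x ∷_) (subsets n)) (trans
      (sumOf-cong (subsets n) λ {R} _ → ℚ.*-assoc (if x then q else 1ℚ ℚ.- q) (weight q R) (f (x ∷ R)))
      (sumOf-* (if x then q else 1ℚ ℚ.- q) (λ R → weight q R ℚ.* f (x ∷ R)) (subsets n)))

indicator : {P : Set} → Dec P → ℚ
indicator P? = if does P? then 1ℚ else 0ℚ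

indicator-cong : ∀ {P Q : Set} (P? : Dec P) (Q? : Dec Q) → (P → Q) → (Q → P) → indicator P? ≡ indicator Q?
indicator-cong (yes _) (yes _) _ _ = refl
indicator-cong (no _)  (no _)  _ _ = refl
indicator-cong (yes p) (no ¬q) f _ = contradiction (f p) ¬q
indicator-cong (no ¬p) (yes q) _ g = contradiction (g q) ¬p

indicator-no : ∀ {P : Set} (P? : Dec P) → ¬ P → indicator P? ≡ 0ℚ
indicator-no (yes p) ¬p = contradiction p ¬p
indicator-no (no _)  _  = refl

toℚ-length-filter : ∀ {A : Set} {P : A → Set} (P? : Decidable P) x xs →
  toℚ (length (filter P? (x ∷ xs))) ≡ indicator (P? x) ℚ.+ toℚ (length (filter P? xs))
toℚ-length-filter P? x xs with P? x
... | yes _ = toℚ-homo-+ 1 (length (filter P? xs))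
... | no  _ = sym (ℚ.+-identityˡ (toℚ (length (filter P? xs))))

-- Condition on one group element at a time. An element absent from `S` imposes nothing and
-- contributes `q + (1 - q) = 1`; one that occurs must be chosen and contributes `q`.
expect-contained : ∀ {n} q (S : Sequence n) → expect q (λ R → indicator (containedIn? R S)) ≡ q ^ supp S
expect-contained q []         = refl
expect-contained {suc n} q (zero ∷ S) = begin
  expect q (λ R → indicator (containedIn? R (zero ∷ S)))
    ≡⟨ expect-suc q (λ R → indicator (containedIn? R (zero ∷ S))) ⟩
  q ℚ.* expect q (λ R → indicator (containedIn? (inside ∷ R) (zero ∷ S))) ℚ.+
    (1ℚ ℚ.- q) ℚ.* expect q (λ R → indicator (containedIn? (outside ∷ R) (zero ∷ S)))
    ≡⟨ cong₂ (λ a b → q ℚ.* a ℚ.+ (1ℚ ℚ.- q) ℚ.* b) (same inside) (same outside) ⟩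
  q ℚ.* (q ^ supp S) ℚ.+ (1ℚ ℚ.- q) ℚ.* (q ^ supp S)
    ≡⟨ solve 2 (λ q a → q :* a :+ (con 1ℚ :- q) :* a := a) refl q (q ^ supp S) ⟩
  q ^ supp S  ∎
  where
    open ≡-Reasoning
    open ℚ-Solver
    same : ∀ x → expect q (λ R → indicator (containedIn? (x ∷ R) (zero ∷ S))) ≡ q ^ supp S
    same x = trans
      (expect-cong q λ R → indicator-cong (containedIn? (x ∷ R) (zero ∷ S)) (containedIn? R S)
        (λ h a 0<S → Subset.drop-there (h (suc a) 0<S))
        (λ { h (suc a) 0<S → Vec.there (h a 0<S) }))
      (expect-contained q S)
expect-contained {suc n} q (suc s ∷ S) = begin
  expect q (λ R → indicator (containedIn? R (suc s ∷ S)))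
    ≡⟨ expect-suc q (λ R → indicator (containedIn? R (suc s ∷ S))) ⟩
  q ℚ.* expect q (λ R → indicator (containedIn? (inside ∷ R) (suc s ∷ S))) ℚ.+
    (1ℚ ℚ.- q) ℚ.* expect q (λ R → indicator (containedIn? (outside ∷ R) (suc s ∷ S)))
    ≡⟨ cong₂ (λ a b → q ℚ.* a ℚ.+ (1ℚ ℚ.- q) ℚ.* b) in-R out-R ⟩
  q ℚ.* (q ^ supp S) ℚ.+ (1ℚ ℚ.- q) ℚ.* 0ℚ
    ≡⟨ solve 2 (λ q a → q :* a :+ (con 1ℚ :- q) :* con 0ℚ := q :* a) refl q (q ^ supp S) ⟩
  q ℚ.* (q ^ supp S)  ∎
  where
    open ≡-Reasoning
    open ℚ-Solver
    in-R : expect q (λ R → indicator (containedIn? (inside ∷ R) (suc s ∷ S))) ≡ q ^ supp S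
    in-R = trans
      (expect-cong q λ R → indicator-cong (containedIn? (inside ∷ R) (suc s ∷ S)) (containedIn? R S)
        (λ h a 0<S → Subset.drop-there (h (suc a) 0<S))
        (λ { h zero _ → Vec.here ; h (suc a) 0<S → Vec.there (h a 0<S) }))
      (expect-contained q S)
    out-R : expect q (λ R → indicator (containedIn? (outside ∷ R) (suc s ∷ S))) ≡ 0ℚ
    out-R = trans
      (expect-cong q λ R → indicator-no (containedIn? (outside ∷ R) (suc s ∷ S)) λ h →
        case h zero (s≤s z≤n) of λ ())
      (expect-0 {n} q)

module _ {n : ℕ} .{{_ : NonZero n}} where

  -- Linearity of expectation, by splitting off the indicator of one sequence at a time. Whether `S`
  -- is zero-sum free does not depend on `R`.
  expect-count : ∀ q (L : List (Sequence n)) →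
    expect q (λ R → toℚ (length (filter (λ S → zeroSumFree? S ×-dec containedIn? R S) L))) ≡
    sumOf (λ S → q ^ supp S) (filter zeroSumFree? L)
  expect-count q []      = expect-0 {n} q
  expect-count q (S ∷ L) = by-cases (zeroSumFree? S)
    where
      open ≡-Reasoning
      count : List (Sequence n) → Subset n → ℕ
      count L R = length (filter (λ S → zeroSumFree? S ×-dec containedIn? R S) L)

      by-cases : Dec (ZeroSumFree S) → expect q (toℚ ∘ count (S ∷ L)) ≡
        sumOf (λ S → q ^ supp S) (filter zeroSumFree? (S ∷ L))
      by-cases (yes free) = begin
        expect q (toℚ ∘ count (S ∷ L))
          ≡⟨ expect-cong q counted ⟩
        expect q (λ R → indicator (containedIn? R S) ℚ.+ toℚ (count L R))
          ≡⟨ expect-+ q (λ R → indicator (containedIn? R S)) (toℚ ∘ count L) ⟩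
        expect q (λ R → indicator (containedIn? R S)) ℚ.+ expect q (toℚ ∘ count L)
          ≡⟨ cong₂ ℚ._+_ (expect-contained q S) (expect-count q L) ⟩
        sumOf (λ S → q ^ supp S) (S ∷ filter zeroSumFree? L)
          ≡⟨ cong (sumOf (λ S → q ^ supp S)) (List.filter-accept zeroSumFree? {x = S} {xs = L} free) ⟨
        sumOf (λ S → q ^ supp S) (filter zeroSumFree? (S ∷ L)) ∎
        where
          counted : ∀ R → toℚ (count (S ∷ L) R) ≡ indicator (containedIn? R S) ℚ.+ toℚ (count L R)
          counted R = trans (toℚ-length-filter (λ S → zeroSumFree? S ×-dec containedIn? R S) S L)
            (cong (ℚ._+ toℚ (count L R))
              (indicator-cong (zeroSumFree? S ×-dec containedIn? R S) (containedIn? R S) proj₂ (free ,_)))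
      by-cases (no ¬free) = begin
        expect q (toℚ ∘ count (S ∷ L))
          ≡⟨ expect-cong q (λ R → cong (toℚ ∘ length)
               (List.filter-reject (λ S → zeroSumFree? S ×-dec containedIn? R S) {x = S} {xs = L} (¬free ∘ proj₁))) ⟩
        expect q (toℚ ∘ count L)
          ≡⟨ expect-count q L ⟩
        sumOf (λ S → q ^ supp S) (filter zeroSumFree? L)
          ≡⟨ cong (sumOf (λ S → q ^ supp S)) (List.filter-reject zeroSumFree? {x = S} {xs = L} ¬free) ⟨
        sumOf (λ S → q ^ supp S) (filter zeroSumFree? (S ∷ L)) ∎

-- Main term and relative error

-- A rational approximation of a real in the unit interval may leave that interval. Eventually it
-- lies between -1 and 2, hence the base 2 where 1 would be expected.
∣^∣≤ : ∀ {q} d m → ℚ.∣ q ∣ ℚ.≤ toℚ 2 → d ℕ.≤ m → ℚ.∣ q ^ d ∣ ℚ.≤ toℚ (2 ℕ.^ m)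
∣^∣≤ zero m _ _ = toℚ-mono (ℕ.m^n>0 2 m)
∣^∣≤ {q} (suc d) (suc m) q≤2 (s≤s d≤m) = subst₂ ℚ._≤_
  (sym (ℚ.∣p*q∣≡∣p∣*∣q∣ q (q ^ d))) (sym (toℚ-homo-* 2 (2 ℕ.^ m)))
  (≤-mul {a = q} {b = q ^ d} q≤2 (∣^∣≤ d m q≤2 d≤m))

-- Used with `f = φ n`, `r` its reciprocal, and `q * q * t` the contribution of supports of size at
-- least 2. One factor `q` joins the main term, and the other makes the relative error of order `q`.
factor : ∀ q f t r {e} → f ℚ.* r ≡ 1ℚ → e ≡ q ℚ.* t ℚ.* r →
  f ℚ.* q ℚ.+ q ℚ.* q ℚ.* t ≡ q ℚ.* f ℚ.* (1ℚ ℚ.+ e)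
factor q f t r fr≡1 refl = begin
  f ℚ.* q ℚ.+ q ℚ.* q ℚ.* t                  ≡⟨ cong (f ℚ.* q ℚ.+_) (ℚ.*-identityʳ (q ℚ.* q ℚ.* t)) ⟨
  f ℚ.* q ℚ.+ q ℚ.* q ℚ.* t ℚ.* 1ℚ           ≡⟨ cong (λ u → f ℚ.* q ℚ.+ q ℚ.* q ℚ.* t ℚ.* u) fr≡1 ⟨
  f ℚ.* q ℚ.+ q ℚ.* q ℚ.* t ℚ.* (f ℚ.* r)
    ≡⟨ solve 4 (λ q f t r → f :* q :+ q :* q :* t :* (f :* r) := q :* f :* (con 1ℚ :+ q :* t :* r)) refl q f t r ⟩
  q ℚ.* f ℚ.* (1ℚ ℚ.+ q ℚ.* t ℚ.* r)         ∎
  where open ≡-Reasoning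
        open ℚ-Solver

-- The implied constant: the number of words for one generator, times a bound for the power of `q`
-- left after `q * q` is factored out.
bound : ℕ → ℕ
bound k = suc (3 ℕ.* k) ℕ.^ (2 ℕ.* k) ℕ.* 2 ℕ.^ (2 ℕ.* k)

0<bound : ∀ k → 0 ℕ.< bound k
0<bound k = ℕ.*-mono-< {0} {_} {0} (ℕ.m^n>0 (suc (3 ℕ.* k)) (2 ℕ.* k)) (ℕ.m^n>0 2 (2 ℕ.* k))

module _ {n : ℕ} .{{_ : NonZero n}} where

  abstract
    1/φ : ℚ
    1/φ = proj₁ (scale (toℚ (φ n)) 1ℚ (0<toℚ 0<φ) (ℚ.positive⁻¹ 1ℚ))

    0<1/φ : 0ℚ ℚ.< 1/φ
    0<1/φ = proj₁ (proj₂ (scale (toℚ (φ n)) 1ℚ (0<toℚ 0<φ) (ℚ.positive⁻¹ 1ℚ)))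

    φ*1/φ : toℚ (φ n) ℚ.* 1/φ ≡ 1ℚ
    φ*1/φ = proj₂ (proj₂ (scale (toℚ (φ n)) 1ℚ (0<toℚ 0<φ) (ℚ.positive⁻¹ 1ℚ)))

  others : ℕ → List (Sequence n)
  others ℓ = filter (λ S → ¬? (supp S ℕ.≟ 1)) (freeSequences ℓ)

  -- In the range treated by `Estimate` every sequence in `others` has support at least 2, so the
  -- truncated subtraction is exact there.
  tail : ℕ → ℚ → ℚ
  tail ℓ q = sumOf (λ S → q ^ (supp S ∸ 2)) (others ℓ)

  -- Abstract, so that conversion checking does not unfold the Cauchy proofs of these reals.
  abstract
    relativeError : ℕ → ℝ → ℝ
    relativeError ℓ p = p * ∑ (map (λ S → p ℝ^.^ (supp S ∸ 2)) (others ℓ)) * fromℚ 1/φ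

    seq-relativeError : ∀ ℓ p i → seq (relativeError ℓ p) i ≡ seq p i ℚ.* tail ℓ (seq p i) ℚ.* 1/φ
    seq-relativeError ℓ p i = cong (λ s → seq p i ℚ.* s ℚ.* 1/φ) (trans
      (seq-∑ (λ S → p ℝ^.^ (supp S ∸ 2)) i (others ℓ))
      (sumOf-cong (others ℓ) λ {S} _ → seq-^ p (supp S ∸ 2) i))

  seq-expectation : ∀ ℓ p i →
    seq (𝔼 p (λ (R : Subset n) → fromℕ (N R ℓ))) i ≡ sumOf (λ S → seq p i ^ supp S) (freeSequences ℓ)
  seq-expectation ℓ p i = begin
    seq (𝔼 p (λ R → fromℕ (N R ℓ))) i               ≡⟨ seq-𝔼 p (λ R → fromℕ (N R ℓ)) i ⟩
    expect (seq p i) (λ R → toℚ (N R ℓ))            ≡⟨ expect-count (seq p i) (sequences n ℓ) ⟩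
    sumOf (λ S → seq p i ^ supp S) (freeSequences ℓ)  ∎
    where open ≡-Reasoning

  expectation-≈ : ∀ ℓ p →
    (∀ i → sumOf (λ S → seq p i ^ supp S) (freeSequences ℓ) ≡
           seq p i ℚ.* toℚ (φ n) ℚ.* (1ℚ ℚ.+ seq (relativeError ℓ p) i)) →
    𝔼 p (λ (R : Subset n) → fromℕ (N R ℓ)) ≈ p * fromℕ (φ n) * (1ℝ + relativeError ℓ p)
  expectation-≈ ℓ p eq =
    pointwise⇒≈ (𝔼 p (λ R → fromℕ (N R ℓ))) (p * fromℕ (φ n) * (1ℝ + relativeError ℓ p)) λ i →
      trans (seq-expectation ℓ p i) (eq i)

  module Estimate (k c ℓ : ℕ) (n≡ : n ≡ 3 ℕ.* k ℕ.+ suc c) (n≤2c : n ℕ.≤ c ℕ.+ c) (ℓ≡ : ℓ ≡ c ℕ.+ 2 ℕ.* k) where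

    open Long k c ℓ n≡ n≤2c ℓ≡

    others⁻ : ∀ {S} → S ∈ others ℓ → S ∈ freeSequences ℓ × 2 ℕ.≤ supp S
    others⁻ S∈ with ∈-filter⁻ (¬? ∘ oneElement?) {xs = freeSequences ℓ} S∈
    ... | S∈′ , ≢1 = S∈′ , ℕ.≤∧≢⇒< (supp>0 S∈′) (≢1 ∘ sym)

    ∣tail∣≤ : ∀ q → ℚ.∣ q ∣ ℚ.≤ toℚ 2 → ℚ.∣ tail ℓ q ∣ ℚ.≤ toℚ (φ n) ℚ.* toℚ (bound k)
    ∣tail∣≤ q q≤2 = begin
      ℚ.∣ tail ℓ q ∣                                     ≤⟨ ∣sumOf∣≤ _ (others ℓ) small ⟩
      toℚ (length (others ℓ)) ℚ.* toℚ (2 ℕ.^ (2 ℕ.* k))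
        ≤⟨ ≤-scaleʳ _ (0≤toℚ (2 ℕ.^ (2 ℕ.* k))) (toℚ-mono few) ⟩
      toℚ (φ n ℕ.* A) ℚ.* toℚ (2 ℕ.^ (2 ℕ.* k))           ≡⟨ toℚ-homo-* (φ n ℕ.* A) _ ⟨
      toℚ (φ n ℕ.* A ℕ.* 2 ℕ.^ (2 ℕ.* k))                 ≡⟨ cong toℚ (ℕ.*-assoc (φ n) A _) ⟩
      toℚ (φ n ℕ.* bound k)                              ≡⟨ toℚ-homo-* (φ n) (bound k) ⟩
      toℚ (φ n) ℚ.* toℚ (bound k)                        ∎
      where
        open ℚ.≤-Reasoning
        A = suc (3 ℕ.* k) ℕ.^ (2 ℕ.* k)

        small : ∀ {S} → S ∈ others ℓ → ℚ.∣ q ^ (supp S ∸ 2) ∣ ℚ.≤ toℚ (2 ℕ.^ (2 ℕ.* k))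
        small {S} S∈ = ∣^∣≤ (supp S ∸ 2) (2 ℕ.* k) q≤2
          (ℕ.≤-trans (ℕ.∸-monoˡ-≤ 2 (supp≤ (proj₁ (others⁻ S∈)))) (ℕ.m∸n≤m (2 ℕ.* k) 1))

        few : length (others ℓ) ℕ.≤ φ n ℕ.* A
        few = ℕ.≤-trans (List.length-filter (¬? ∘ oneElement?) (freeSequences ℓ)) length-freeSequences

    -- The `φ n` in the bound for `tail` cancels against `1/φ`, leaving `B * |q|`. Approximations of
    -- a nonnegative `p` may be slightly negative, but `q ≥ -δ/2` gives `|q| ≤ q + δ`; the choice
    -- `δ = ε / B` makes the total loss `ε`.
    ∣relativeError∣≤ : ∀ p → 0ℝ ≤ p → p ≤ 1ℝ → ∣ relativeError ℓ p ∣ ≤ fromℕ (bound k) * p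
    ∣relativeError∣≤ p 0≤p p≤1 ε 0<ε = both combine (0≤p (½ ℚ.* δ) (half 0<δ))
      (both (λ _ → _,_) (0≤p 1ℚ (ℚ.positive⁻¹ 1ℚ)) (p≤1 1ℚ (ℚ.positive⁻¹ 1ℚ)))
      where
        B = toℚ (bound k)
        δ-scale = scale B ε (0<toℚ (0<bound k)) 0<ε
        δ = proj₁ δ-scale
        0<δ = proj₁ (proj₂ δ-scale)
        B*δ≡ε = proj₂ (proj₂ δ-scale)

        abs≤ : ∀ {a b} → a ℚ.≤ b → ℚ.- a ℚ.≤ b → ℚ.∣ a ∣ ℚ.≤ b
        abs≤ {a} {b} a≤b -a≤b with ℚ.∣p∣≡p∨∣p∣≡-p a
        ... | inj₁ eq = subst (ℚ._≤ b) (sym eq) a≤b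
        ... | inj₂ eq = subst (ℚ._≤ b) (sym eq) -a≤b

        combine : ∀ i → 0ℚ ℚ.≤ seq p i ℚ.+ ½ ℚ.* δ → 0ℚ ℚ.≤ seq p i ℚ.+ 1ℚ × seq p i ℚ.≤ 1ℚ ℚ.+ 1ℚ →
          seq (∣ relativeError ℓ p ∣) i ℚ.≤ seq (fromℕ (bound k) * p) i ℚ.+ ε
        combine i lo (lo₁ , hi) = begin
          ℚ.∣ seq (relativeError ℓ p) i ∣                ≡⟨ cong ℚ.∣_∣ (seq-relativeError ℓ p i) ⟩
          ℚ.∣ q ℚ.* tail ℓ q ℚ.* 1/φ ∣                   ≡⟨ ℚ.∣p*q∣≡∣p∣*∣q∣ (q ℚ.* tail ℓ q) 1/φ ⟩
          ℚ.∣ q ℚ.* tail ℓ q ∣ ℚ.* ℚ.∣ 1/φ ∣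
            ≡⟨ cong₂ ℚ._*_ (ℚ.∣p*q∣≡∣p∣*∣q∣ q (tail ℓ q)) (ℚ.0≤p⇒∣p∣≡p (ℚ.<⇒≤ 0<1/φ)) ⟩
          ℚ.∣ q ∣ ℚ.* ℚ.∣ tail ℓ q ∣ ℚ.* 1/φ
            ≤⟨ ≤-scaleʳ 1/φ (ℚ.<⇒≤ 0<1/φ) (≤-scaleˡ ℚ.∣ q ∣ (ℚ.0≤∣p∣ q) (∣tail∣≤ q (abs≤ hi -q≤2))) ⟩
          ℚ.∣ q ∣ ℚ.* (toℚ (φ n) ℚ.* B) ℚ.* 1/φ
            ≡⟨ solve 4 (λ q f b r → q :* (f :* b) :* r := b :* q :* (f :* r)) refl ℚ.∣ q ∣ (toℚ (φ n)) B 1/φ ⟩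
          B ℚ.* ℚ.∣ q ∣ ℚ.* (toℚ (φ n) ℚ.* 1/φ)
            ≡⟨ trans (cong (B ℚ.* ℚ.∣ q ∣ ℚ.*_) φ*1/φ) (ℚ.*-identityʳ _) ⟩
          B ℚ.* ℚ.∣ q ∣                                  ≤⟨ ≤-scaleˡ B (0≤toℚ (bound k)) (abs≤ q≤q+δ -q≤q+δ) ⟩
          B ℚ.* (q ℚ.+ δ)
            ≡⟨ trans (ℚ.*-distribˡ-+ B q δ) (cong (B ℚ.* q ℚ.+_) B*δ≡ε) ⟩
          B ℚ.* q ℚ.+ ε                                  ∎
          where
            open ℚ.≤-Reasoning
            open ℚ-Solver
            q = seq p i

            -q≤2 : ℚ.- q ℚ.≤ toℚ 2
            -q≤2 = ℚ.≤-trans (subst₂ ℚ._≤_ (ℚ.+-identityˡ (ℚ.- q))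
              (solve 1 (λ q → q :+ con 1ℚ :- q := con 1ℚ) refl q)
              (ℚ.+-monoˡ-≤ (ℚ.- q) lo₁)) (toℚ-mono {1} {2} (s≤s z≤n))

            q≤q+δ : q ℚ.≤ q ℚ.+ δ
            q≤q+δ = subst (ℚ._≤ q ℚ.+ δ) (ℚ.+-identityʳ q) (ℚ.+-monoʳ-≤ q (ℚ.<⇒≤ 0<δ))

            -- Twice the inequality `0 ≤ q + δ/2`, with one `q` moved across.
            -q≤q+δ : ℚ.- q ℚ.≤ q ℚ.+ δ
            -q≤q+δ = subst₂ ℚ._≤_
              (solve 1 (λ q → con 0ℚ :+ con 0ℚ :- q := :- q) refl q)
              (trans (solve 2 (λ q h → (q :+ h) :+ (q :+ h) :- q := q :+ (h :+ h)) refl q (½ ℚ.* δ))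
                     (cong (q ℚ.+_) (halves δ)))
              (ℚ.+-monoˡ-≤ (ℚ.- q) (ℚ.+-mono-≤ lo lo))

    -- Split by support: size 1 occurs once per generator and gives `φ n * q`, while `q * q` factors
    -- out of all other terms.
    sum-freeSequences : ∀ {q e} → e ≡ q ℚ.* tail ℓ q ℚ.* 1/φ →
      sumOf (λ S → q ^ supp S) (freeSequences ℓ) ≡ q ℚ.* toℚ (φ n) ℚ.* (1ℚ ℚ.+ e)
    sum-freeSequences {q} {e} e≡ = trans
      (sumOf-split oneElement? (λ S → q ^ supp S) (freeSequences ℓ))
      (trans (cong₂ ℚ._+_ main rest) (factor q (toℚ (φ n)) (tail ℓ q) 1/φ φ*1/φ e≡))
      where
        main : sumOf (λ S → q ^ supp S) (filter oneElement? (freeSequences ℓ)) ≡ toℚ (φ n) ℚ.* q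
        main = trans
          (sumOf-cong (filter oneElement? (freeSequences ℓ)) λ S∈ → trans
            (cong (q ^_) (proj₂ (∈-filter⁻ oneElement? {xs = freeSequences ℓ} S∈))) (ℚ.*-identityʳ q))
          (trans (sumOf-const q (filter oneElement? (freeSequences ℓ)))
                 (cong (λ m → toℚ m ℚ.* q) length-oneElement))

        rest : sumOf (λ S → q ^ supp S) (others ℓ) ≡ q ℚ.* q ℚ.* tail ℓ q
        rest = trans
          (sumOf-cong (others ℓ) λ {S} S∈ → trans
            (cong (q ^_) (sym (ℕ.m+[n∸m]≡n (proj₂ (others⁻ S∈)))))
            (sym (ℚ.*-assoc q q (q ^ (supp S ∸ 2)))))
          (sumOf-* (q ℚ.* q) (λ S → q ^ (supp S ∸ 2)) (others ℓ))

    expectation : ∀ p → 𝔼 p (λ (R : Subset n) → fromℕ (N R ℓ)) ≈ p * fromℕ (φ n) * (1ℝ + relativeError ℓ p)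
    expectation p = expectation-≈ ℓ p λ i →
      sum-freeSequences {seq p i} {seq (relativeError ℓ p) i} (seq-relativeError ℓ p i)

-- Passage to all large `n`

-- Writing `n` as `suc (3k) + c`, the threshold of twice `suc (3k)` says `suc (3k) ≤ c`, which is
-- the majority condition `n ≤ c + c`.
lengthSplit : ∀ k n → suc (3 ℕ.* k) ℕ.+ suc (3 ℕ.* k) ℕ.≤ n →
  ∃ λ c → n ≡ 3 ℕ.* k ℕ.+ suc c × n ℕ.≤ c ℕ.+ c × n ∸ 1 ∸ k ≡ c ℕ.+ 2 ℕ.* k
lengthSplit k n 2m≤n with ℕ.m≤n⇒∃[o]m+o≡n (ℕ.m+n≤o⇒m≤o (suc (3 ℕ.* k)) 2m≤n)
... | c , refl = c , sym (ℕ.+-suc (3 ℕ.* k) c) ,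
    ℕ.+-monoˡ-≤ c (ℕ.+-cancelˡ-≤ (suc (3 ℕ.* k)) (suc (3 ℕ.* k)) c 2m≤n) ,
    trans (cong (_∸ k) (solve 2 (λ k c → con 3 :* k :+ c := k :+ (c :+ con 2 :* k)) refl k c))
      (ℕ.m+n∸m≡n k (c ℕ.+ 2 ℕ.* k))
  where open +-*-Solver

-- There is no cyclic group of order 0, so the value at 0 is only a filler for a function on all of
-- `ℕ`.
error : ℕ → (ℕ → ℝ) → ℕ → ℝ
error k p zero      = 0ℝ
error k p n@(suc _) = relativeError {n} (n ∸ 1 ∸ k) (p n)

error-nonZero : ∀ k p n .{{_ : NonZero n}} → error k p n ≡ relativeError {n} (n ∸ 1 ∸ k) (p n)
error-nonZero k p (suc n) = refl

estimate : ∀ k n .{{_ : NonZero n}} p → 0ℝ ≤ p × p ≤ 1ℝ → suc (3 ℕ.* k) ℕ.+ suc (3 ℕ.* k) ℕ.≤ n →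
  ∣ relativeError {n} (n ∸ 1 ∸ k) p ∣ ≤ fromℕ (bound k) * p ×
  𝔼 p (λ (R : Subset n) → fromℕ (N R (n ∸ 1 ∸ k))) ≈ p * fromℕ (φ n) * (1ℝ + relativeError {n} (n ∸ 1 ∸ k) p)
estimate k n p (0≤p , p≤1) 2m≤n =
  let c , n≡ , n≤2c , ℓ≡ = lengthSplit k n 2m≤n
  in Estimate.∣relativeError∣≤ {n} k c (n ∸ 1 ∸ k) n≡ n≤2c ℓ≡ p 0≤p p≤1 ,
     Estimate.expectation {n} k c (n ∸ 1 ∸ k) n≡ n≤2c ℓ≡ p

corollary3 : (k : ℕ) →
    ∃ λ (K : ℝ) →
    (p : ℕ → ℝ) →
    (∀ n → 0ℝ ≤ p n × p n ≤ 1ℝ) →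
    TendsToZero p →
    ∃ λ (ε : ℕ → ℝ) →
    ∃ λ (n₀ : ℕ) →
    ∀ n → .{{_ : NonZero n}} → n₀ ℕ.≤ n →
    ∣ ε n ∣ ≤ K * p n ×
    𝔼 (p n) (λ (R : Subset n) → fromℕ (N R (n ∸ 1 ∸ k))) ≈ p n * fromℕ (φ n) * (1ℝ + ε n)
corollary3 k = fromℕ (bound k) , λ p p-prob _ →
  error k p , suc (3 ℕ.* k) ℕ.+ suc (3 ℕ.* k) , λ n {{n≢0}} 2m≤n → subst
    (λ e → ∣ e ∣ ≤ fromℕ (bound k) * p n ×
           𝔼 (p n) (λ (R : Subset n) → fromℕ (N R (n ∸ 1 ∸ k))) ≈ p n * fromℕ (φ n) * (1ℝ + e))
    (sym (error-nonZero k p n {{n≢0}}))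
    (estimate k n {{n≢0}} (p n) (p-prob n) 2m≤n)
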